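{- Let $k\ge 3$ and let $\mathbf w$ be a recurrent balanced weakly rich infinite word with alphabet exactly $\{1,2,\ldots,k\}$. Then, up to a permutation of the letters, $\mathbf w$ is either (1) a shift of the periodic word $\psi_1^n\circ\psi_2\circ\cdots\circ\psi_{k-1}(k^\omega)$ for some $n\ge1$; or (2) a shift of the periodic word $\sigma_1\circ\sigma_2\circ\cdots\circ\sigma_j\circ\psi_{j+1}^2\circ\psi_{j+2}\circ\cdots\circ\psi_{k-1}(k^\omega)$ for some $1\le j\le k-2$.
   Context: An infinite word $\mathbf w$ over $\mathcal A$ is weakly rich if for every letter $a\in\mathcal A$, every complete return to $a$ in $\mathbf w$ is a palindrome, where a complete return to $u$ is a factor containing exactly two occurrences of $u$, one as prefix and one as suffix. Recurrent: every factor occurs infinitely often. Balanced: for any two factors $u,v$ of equal length and any letter $x$, the numbers of occurrences of $x$ in $u$ and $v$ differ by at most 1. A shift of $\mathbf x=x_1x_2\cdots$ is a word $x_{i+1}x_{i+2}\cdots$, $i\ge0$. For a letter $a$, $\psi_a$ is the morphism $a\mapsto a$, $x\mapsto ax$ for $x\ne a$. For a letter $a$ not occurring in $\mathbf x=x_1x_2x_3\cdots$, $\sigma_a(\mathbf x)=a x_1 a^{\epsilon_1}x_2a^{\epsilon_2}x_3a^{\epsilon_3}\cdots$ where $\epsilon_i=2$ if $x_i=x_{i+1}$ and $\epsilon_i=1$ otherwise. $k^\omega$ denotes $kkk\cdots$. -}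

module Defs where

open import Data.Nat using (ℕ; zero; suc; _+_; _∸_; _≤_; _<_; _≟_)
open import Data.List using (List; []; _∷_; _++_; map; concatMap; upTo)
open import Data.Product using (Σ; ∃; _×_; _,_)
open import Data.Sum using (_⊎_)
open import Relation.Nullary using (¬_; yes; no)
open import Relation.Binary.PropositionalEquality using (_≡_)
open import Function.Bundles using (_↔_; Inverse)

-- Letters are natural numbers; an infinite word is a function ℕ → ℕ
-- (position 0 is the first letter).
Word : Set
Word = ℕ → ℕ

prefix : Word → ℕ → List ℕ
prefix x m = map x (upTo m)

nth : ℕ → List ℕ → ℕ → ℕ
nth d [] n = d
nth d (y ∷ ys) zero = y
nth d (y ∷ ys) (suc n) = nth d ys n

ψfin : ℕ → List ℕ → List ℕ
ψfin a = concatMap (λ x → step x)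
  where
  step : ℕ → List ℕ
  step x with x ≟ a
  ... | yes _ = a ∷ []
  ... | no _  = a ∷ x ∷ []

-- σ_a on a finite word x₁⋯x_m gives a x₁ a^{ε₁} x₂ ⋯ a^{ε_{m-1}} x_m,
-- which is a prefix of σ_a applied to any infinite word beginning with x₁⋯x_m.
σgo : ℕ → ℕ → List ℕ → List ℕ
σgo a x [] = x ∷ []
σgo a x (y ∷ ys) with x ≟ y
... | yes _ = x ∷ a ∷ a ∷ σgo a y ys
... | no _  = x ∷ a ∷ σgo a y ys

σfin : ℕ → List ℕ → List ℕ
σfin a [] = []
σfin a (x ∷ xs) = a ∷ σgo a x xs

-- Extending a prefix-compatible, non-shortening map on finite words to infinite
-- words: the n-th letter of the image is the n-th letter of the image of the
-- prefix of length n+1 (which has length ≥ n+1 for ψfin and σfin).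
extend : ℕ → (List ℕ → List ℕ) → Word → Word
extend d f x n = nth d (f (prefix x (suc n))) n

ψ : ℕ → Word → Word
ψ a = extend a (ψfin a)

σ : ℕ → Word → Word
σ a = extend a (σfin a)

constW : ℕ → Word
constW k _ = k

ψRange : ℕ → ℕ → Word → Word
ψRange j zero x = x
ψRange j (suc c) x = ψ j (ψRange (suc j) c x)

σRange : ℕ → ℕ → Word → Word
σRange j zero x = x
σRange j (suc c) x = σ j (σRange (suc j) c x)

iter : (Word → Word) → ℕ → Word → Word
iter f zero x = x
iter f (suc n) x = f (iter f n x)

word1 : ℕ → ℕ → Word
word1 k n = iter (ψ 1) n (ψRange 2 (k ∸ 2) (constW k))

word2 : ℕ → ℕ → Word
word2 k j = σRange 1 j (ψ (suc j) (ψRange (suc j) (k ∸ suc j) (constW k)))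

count : Word → ℕ → ℕ → ℕ → ℕ
count w a i zero = 0
count w a i (suc n) with w (i + n) ≟ a
... | yes _ = suc (count w a i n)
... | no _  = count w a i n

AlphabetExactly : ℕ → Word → Set
AlphabetExactly k w =
  (∀ i → 1 ≤ w i × w i ≤ k) × (∀ a → 1 ≤ a → a ≤ k → ∃ λ i → w i ≡ a)

Recurrent : Word → Set
Recurrent w = ∀ i n m → ∃ λ p → m ≤ p × (∀ t → t < n → w (p + t) ≡ w (i + t))

Balanced : Word → Set
Balanced w = ∀ i j n a → count w a i n ≤ suc (count w a j n)

PalFactor : Word → ℕ → ℕ → Set
PalFactor w i j = ∀ t → t ≤ j ∸ i → w (i + t) ≡ w (j ∸ t)

CompleteReturnLetter : Word → ℕ → ℕ → ℕ → Set
CompleteReturnLetter w a i j =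
  i < j × w i ≡ a × w j ≡ a × (∀ t → i < t → t < j → ¬ (w t ≡ a))

WeaklyRich : Word → Set
WeaklyRich w = ∀ a i j → CompleteReturnLetter w a i j → PalFactor w i j

ShiftUpTo : (ℕ ↔ ℕ) → ℕ → Word → Word → Set
ShiftUpTo π s v w = ∀ n → w n ≡ Inverse.to π (v (s + n))

{-# OPTIONS --safe #-}
module Submission where

-- The gaps between consecutive occurrences of a letter differ by at most 1, and the
-- centre of a palindromic complete return is a square aa or a factor aba. Hence some
-- letter a has gaps at most 2, i.e. w is a word y without a, with runs a^f inserted.
-- If y has no square of a letter, some letter of y has gap 2 in y; balance makes this gap
-- and f constant, so all gaps in y are constant and y is a ruler word (case 1).
-- If bb occurs in y, balance of the occurrences of b forces f = 2 inside bb and f = 1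
-- elsewhere, so w = σ_a(y), and b separates the letters of y. Deleting b from y gives the
-- same situation with the block aba in place of a; balance of a excludes bbb. The process
-- ends when the remaining word is constant or has no squares of letters; consecutive
-- letters of it are then separated by exactly two blocks (case 2).
-- Squares are decidable because in the presence of a square w turns out to be periodic
-- with a period bounded in terms of k, or to have a square among its first letters.

open import Defs
open import Data.Nat using (ℕ; zero; suc; _+_; _*_; _∸_; _^_; _≤_; _<_; _≟_; z≤n; s≤s)
open import Data.Nat.DivMod using (_/_; _%_; m≡m%n+[m/n]*n; m%n<n)
open import Data.Nat.Properties
open import Data.Nat.Tactic.RingSolver using (solve-∀)
open import Data.List using (List; []; _∷_; _++_; length; map; upTo)
open import Data.List.Properties using (upTo-∷ʳ; map-++; concatMap-++; length-++; ++-identityʳ; ++-assoc; length-map; length-upTo)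
open import Data.List.Membership.Propositional using (_∈_)
open import Data.List.Membership.Propositional.Properties using (∈-map⁺; ∈-map⁻; ∈-upTo⁺; ∈-upTo⁻)
open import Data.List.Relation.Unary.Any using (here; there)
open import Data.List.Relation.Unary.All as All using (All; []; _∷_)
import Data.List.Relation.Unary.All.Properties as All
open import Data.List.Relation.Unary.AllPairs using ([]; _∷_)
open import Data.List.Relation.Unary.Unique.Propositional using (Unique)
import Data.List.Relation.Unary.Unique.Propositional.Properties as Unique
open import Data.Product using (Σ; ∃; _×_; _,_; proj₁; proj₂)
open import Data.Sum using (_⊎_; inj₁; inj₂)
open import Data.Empty using (⊥; ⊥-elim)
open import Function using (_∘_; id)
open import Function.Bundles using (_↔_; Inverse; mk↔ₛ′)
open import Function.Construct.Composition using (_↔-∘_)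
open import Relation.Binary using (tri<; tri≈; tri>)
open import Relation.Binary.PropositionalEquality
open import Relation.Nullary using (¬_; Dec; yes; no)
open import Relation.Nullary.Decidable using (¬?; decidable-stable)

-- Infinite words as limits of growing finite images.

nth-++ˡ : ∀ d xs ys n → n < length xs → nth d (xs ++ ys) n ≡ nth d xs n
nth-++ˡ d (x ∷ xs) ys zero    _       = refl
nth-++ˡ d (x ∷ xs) ys (suc n) (s≤s h) = nth-++ˡ d xs ys n h

nth-++ʳ : ∀ d xs ys n → nth d (xs ++ ys) (length xs + n) ≡ nth d ys n
nth-++ʳ d []       ys n = refl
nth-++ʳ d (x ∷ xs) ys n = nth-++ʳ d xs ys n

nth-All : ∀ {Q : ℕ → Set} {d xs} → Q d → All Q xs → ∀ n → Q (nth d xs n)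
nth-All qd []       n       = qd
nth-All qd (q ∷ qs) zero    = q
nth-All qd (q ∷ qs) (suc n) = nth-All qd qs n

prefix-suc : ∀ x m → prefix x (suc m) ≡ prefix x m ++ x m ∷ []
prefix-suc x m = trans (cong (map x) (sym (upTo-∷ʳ m))) (map-++ x (upTo m) (m ∷ []))

-- The block `B i` is indexed by the position and not by the letter, because for σ it depends on the
-- preceding letter as well.
record Grows (F : List ℕ → List ℕ) (x : Word) (B : ℕ → List ℕ) : Set where
  field
    block    : ∀ i → F (prefix x (suc i)) ≡ F (prefix x i) ++ B i
    nonempty : ∀ i → 1 ≤ length (B i)

grows-≤ : ∀ {F x B} → Grows F x B → ∀ i → i ≤ length (F (prefix x i))
grows-≤ g zero = z≤n
grows-≤ {F} {x} {B} g (suc i) = begin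
  suc i                                    ≡⟨ +-comm 1 i ⟩
  i + 1                                    ≤⟨ +-mono-≤ (grows-≤ g i) (Grows.nonempty g i) ⟩
  length (F (prefix x i)) + length (B i)   ≡⟨ length-++ (F (prefix x i)) ⟨
  length (F (prefix x i) ++ B i)           ≡⟨ cong length (Grows.block g i) ⟨
  length (F (prefix x (suc i)))            ∎
  where open ≤-Reasoning

grows-extends : ∀ {F x B} → Grows F x B → ∀ i m →
  ∃ λ C → F (prefix x (m + i)) ≡ F (prefix x i) ++ C
grows-extends {F} {x} g i zero = [] , sym (++-identityʳ (F (prefix x i)))
grows-extends {F} {x} {B} g i (suc m) with grows-extends g i m
... | C , e = C ++ B (m + i) ,
  trans (Grows.block g (m + i)) (trans (cong (_++ B (m + i)) e) (++-assoc (F (prefix x i)) C (B (m + i))))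

-- `extend` reads letter `n` off the image of the prefix of length `suc n`. Blocks are nonempty, so
-- the position in question is at least `i`, and that prefix already contains letter `i` with its
-- complete block.
extend-block : ∀ {F x B} d → Grows F x B → ∀ i t → t < length (B i) →
  extend d F x (length (F (prefix x i)) + t) ≡ nth d (B i) t
extend-block {F} {x} {B} d g i t t< with m≤n⇒∃[o]m+o≡n (≤-trans (grows-≤ g i) (m≤m+n _ t))
... | o , e with grows-extends g (suc i) o
... | C , e′ = begin
  nth d (F (prefix x (suc n))) n
    ≡⟨ cong (λ z → nth d (F (prefix x z)) n) (trans (cong suc (trans (sym e) (+-comm i o))) (sym (+-suc o i))) ⟩
  nth d (F (prefix x (o + suc i))) n
    ≡⟨ cong (λ z → nth d z n) (trans e′ (cong (_++ C) (Grows.block g i))) ⟩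
  nth d ((F (prefix x i) ++ B i) ++ C) n
    ≡⟨ cong (λ z → nth d z n) (++-assoc (F (prefix x i)) (B i) C) ⟩
  nth d (F (prefix x i) ++ (B i ++ C)) n
    ≡⟨ nth-++ʳ d (F (prefix x i)) (B i ++ C) t ⟩
  nth d (B i ++ C) t
    ≡⟨ nth-++ˡ d (B i) C t t< ⟩
  nth d (B i) t ∎
  where
  open ≡-Reasoning
  n = length (F (prefix x i)) + t

-- x contains the letters x (q 0), x (q 1), …, with a run of f i letters b after x (q i);
-- nothing is said about x before position q 0.
record Gaps (x : Word) (b : ℕ) (q f : ℕ → ℕ) : Set where
  field
    step : ∀ i → q (suc i) ≡ suc (q i + f i)
    keep : ∀ i → x (q i) ≢ b
    fill : ∀ i t → t < f i → x (suc (q i + t)) ≡ b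

-- The morphism ψ

ψpos : ℕ → Word → ℕ → ℕ
ψpos a u i = length (ψfin a (prefix u i))

ψ-grows : ∀ a u → Grows (ψfin a) u (λ i → ψfin a (u i ∷ []))
ψ-grows a u = record
  { block    = λ i → trans (cong (ψfin a) (prefix-suc u i)) (concatMap-++ _ (prefix u i) (u i ∷ []))
  ; nonempty = λ i → pos (u i) }
  where
  pos : ∀ y → 1 ≤ length (ψfin a (y ∷ []))
  pos y with y ≟ a
  ... | yes _ = s≤s z≤n
  ... | no  _ = s≤s z≤n

ψpos-suc : ∀ a u i → ψpos a u (suc i) ≡ ψpos a u i + length (ψfin a (u i ∷ []))
ψpos-suc a u i = trans (cong length (Grows.block (ψ-grows a u) i)) (length-++ (ψfin a (prefix u i)))

ψpos-≡ : ∀ a u i → u i ≡ a → ψpos a u (suc i) ≡ suc (ψpos a u i)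
ψpos-≡ a u i e = trans (ψpos-suc a u i) (trans (cong (ψpos a u i +_) (len (u i) e)) (+-comm _ 1))
  where
  len : ∀ y → y ≡ a → length (ψfin a (y ∷ [])) ≡ 1
  len y e with y ≟ a
  ... | yes _ = refl
  ... | no ne = ⊥-elim (ne e)

ψpos-≢ : ∀ a u i → u i ≢ a → ψpos a u (suc i) ≡ 2 + ψpos a u i
ψpos-≢ a u i ne = trans (ψpos-suc a u i) (trans (cong (ψpos a u i +_) (len (u i) ne)) (+-comm _ 2))
  where
  len : ∀ y → y ≢ a → length (ψfin a (y ∷ [])) ≡ 2
  len y ne with y ≟ a
  ... | yes e = ⊥-elim (ne e)
  ... | no _  = refl

ψ-head : ∀ a u i → ψ a u (ψpos a u i) ≡ a
ψ-head a u i = trans (cong (ψ a u) (sym (+-identityʳ _)))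
  (trans (extend-block a (ψ-grows a u) i 0 (Grows.nonempty (ψ-grows a u) i)) (first (u i)))
  where
  first : ∀ y → nth a (ψfin a (y ∷ [])) 0 ≡ a
  first y with y ≟ a
  ... | yes _ = refl
  ... | no  _ = refl

ψ-second : ∀ a u i → u i ≢ a → ψ a u (suc (ψpos a u i)) ≡ u i
ψ-second a u i ne = trans (cong (ψ a u) (+-comm 1 _))
  (trans (extend-block a (ψ-grows a u) i 1 (proj₁ (second (u i) ne))) (proj₂ (second (u i) ne)))
  where
  second : ∀ y → y ≢ a → 2 ≤ length (ψfin a (y ∷ [])) × nth a (ψfin a (y ∷ [])) 1 ≡ y
  second y ne with y ≟ a
  ... | yes e = ⊥-elim (ne e)
  ... | no  _ = s≤s (s≤s z≤n) , refl

-- ψ maps each `a` to itself, so a run only gains the `a` put in front of the next kept letter. A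
-- kept letter is the second letter of its image, hence the `suc` in its position.
ψ-gaps : ∀ {a u q f} → Gaps u a q f →
  Gaps (ψ a u) a (λ i → suc (ψpos a u (q i))) (suc ∘ f) × (∀ i → ψ a u (suc (ψpos a u (q i))) ≡ u (q i))
ψ-gaps {a} {u} {q} {f} g = record { step = step′ ; keep = keep′ ; fill = fill′ } , λ i → ψ-second a u (q i) (keep i)
  where
  open Gaps g
  run : ∀ i t → t ≤ f i → ψpos a u (suc (q i + t)) ≡ suc (suc (ψpos a u (q i)) + t)
  run i zero _ rewrite +-identityʳ (q i) | +-identityʳ (ψpos a u (q i)) = ψpos-≢ a u (q i) (keep i)
  run i (suc t) t< rewrite +-suc (q i) t | +-suc (ψpos a u (q i)) t =
    trans (ψpos-≡ a u (suc (q i + t)) (fill i t t<)) (cong suc (run i t (<⇒≤ t<)))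
  step′ : ∀ i → suc (ψpos a u (q (suc i))) ≡ suc (suc (ψpos a u (q i)) + suc (f i))
  step′ i rewrite step i | run i (f i) ≤-refl | +-suc (ψpos a u (q i)) (f i) = refl
  keep′ : ∀ i → ψ a u (suc (ψpos a u (q i))) ≢ a
  keep′ i rewrite ψ-second a u (q i) (keep i) = keep i
  fill′ : ∀ i t → t < suc (f i) → ψ a u (suc (suc (ψpos a u (q i)) + t)) ≡ a
  fill′ i t (s≤s t≤) = trans (cong (ψ a u) (sym (run i t t≤))) (ψ-head a u (suc (q i + t)))

iterψ-gaps : ∀ {a V} → (∀ i → V i ≢ a) → ∀ n →
  ∃ λ q → Gaps (iter (ψ a) n V) a q (λ _ → n) × (∀ i → iter (ψ a) n V (q i) ≡ V i)
iterψ-gaps a∉V zero = id , record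
  { step = λ i → cong suc (sym (+-identityʳ i)) ; keep = a∉V ; fill = λ _ _ () } , λ _ → refl
iterψ-gaps a∉V (suc n) with iterψ-gaps a∉V n
... | q , g , e = _ , proj₁ (ψ-gaps g) , λ i → trans (proj₂ (ψ-gaps g) i) (e i)

-- The map σ

ε : ℕ → ℕ → ℕ
ε x y with x ≟ y
... | yes _ = 2
... | no _  = 1

ε-≡ : ∀ {x y} → x ≡ y → ε x y ≡ 2
ε-≡ {x} {y} e with x ≟ y
... | yes _ = refl
... | no ne = ⊥-elim (ne e)

ε-≢ : ∀ {x y} → x ≢ y → ε x y ≡ 1
ε-≢ {x} {y} ne with x ≟ y
... | yes e = ⊥-elim (ne e)
... | no _  = refl

-- What the image gains when `y` is appended after `x`: `σgo` recurses from the left, but the growth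
-- along prefixes happens on the right.
σblock : ℕ → ℕ → ℕ → List ℕ
σblock a x y with x ≟ y
... | yes _ = a ∷ a ∷ y ∷ []
... | no _  = a ∷ y ∷ []

σgo-single : ∀ a x y → σgo a x (y ∷ []) ≡ x ∷ σblock a x y
σgo-single a x y with x ≟ y
... | yes _ = refl
... | no  _ = refl

σgo-∷ʳ : ∀ a x ys y z → σgo a x (ys ++ y ∷ z ∷ []) ≡ σgo a x (ys ++ y ∷ []) ++ σblock a y z
σgo-∷ʳ a x [] y z with x ≟ y
... | yes _ = cong (λ l → x ∷ a ∷ a ∷ l) (σgo-single a y z)
... | no  _ = cong (λ l → x ∷ a ∷ l) (σgo-single a y z)
σgo-∷ʳ a x (w ∷ ys) y z with x ≟ w
... | yes _ = cong (λ l → x ∷ a ∷ a ∷ l) (σgo-∷ʳ a w ys y z)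
... | no  _ = cong (λ l → x ∷ a ∷ l) (σgo-∷ʳ a w ys y z)

σfin-∷ʳ : ∀ a xs y z → σfin a (xs ++ y ∷ z ∷ []) ≡ σfin a (xs ++ y ∷ []) ++ σblock a y z
σfin-∷ʳ a [] y z = cong (a ∷_) (σgo-single a y z)
σfin-∷ʳ a (x ∷ xs) y z = cong (a ∷_) (σgo-∷ʳ a x xs y z)

σB : ℕ → Word → ℕ → List ℕ
σB a V zero    = a ∷ V 0 ∷ []
σB a V (suc i) = σblock a (V i) (V (suc i))

σ-grows : ∀ a V → Grows (σfin a) V (σB a V)
σ-grows a V = record { block = block ; nonempty = pos }
  where
  pos′ : ∀ x y → 1 ≤ length (σblock a x y)
  pos′ x y with x ≟ y
  ... | yes _ = s≤s z≤n
  ... | no  _ = s≤s z≤n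
  pos : ∀ i → 1 ≤ length (σB a V i)
  pos zero    = s≤s z≤n
  pos (suc i) = pos′ (V i) (V (suc i))
  open ≡-Reasoning
  block : ∀ i → σfin a (prefix V (suc i)) ≡ σfin a (prefix V i) ++ σB a V i
  block zero    = refl
  block (suc i) = begin
    σfin a (prefix V (2 + i))
      ≡⟨ cong (σfin a) (trans (prefix-suc V (suc i)) (cong (_++ V (suc i) ∷ []) (prefix-suc V i))) ⟩
    σfin a ((prefix V i ++ V i ∷ []) ++ V (suc i) ∷ [])
      ≡⟨ cong (σfin a) (++-assoc (prefix V i) (V i ∷ []) (V (suc i) ∷ [])) ⟩
    σfin a (prefix V i ++ V i ∷ V (suc i) ∷ [])
      ≡⟨ σfin-∷ʳ a (prefix V i) (V i) (V (suc i)) ⟩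
    σfin a (prefix V i ++ V i ∷ []) ++ σblock a (V i) (V (suc i))
      ≡⟨ cong (λ l → σfin a l ++ σblock a (V i) (V (suc i))) (prefix-suc V i) ⟨
    σfin a (prefix V (suc i)) ++ σblock a (V i) (V (suc i)) ∎

σpos : Word → ℕ → ℕ
σpos V zero    = 1
σpos V (suc i) = suc (σpos V i + ε (V i) (V (suc i)))

length-σblock : ∀ a x y → length (σblock a x y) ≡ suc (ε x y)
length-σblock a x y with x ≟ y
... | yes _ = refl
... | no  _ = refl

σpos-length : ∀ a V i → length (σfin a (prefix V (suc i))) ≡ suc (σpos V i)
σpos-length a V zero = refl
σpos-length a V (suc i) = trans (cong length (Grows.block (σ-grows a V) (suc i)))
  (trans (length-++ (σfin a (prefix V (suc i))))
    (trans (cong₂ _+_ (σpos-length a V i) (length-σblock a (V i) (V (suc i)))) (cong suc (+-suc _ _))))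

σ-block : ∀ a V i t → t < suc (ε (V i) (V (suc i))) →
  σ a V (suc (σpos V i + t)) ≡ nth a (σblock a (V i) (V (suc i))) t
σ-block a V i t t< = trans (cong (λ z → σ a V (z + t)) (sym (σpos-length a V i)))
  (extend-block a (σ-grows a V) (suc i) t (subst (t <_) (sym (length-σblock a (V i) (V (suc i)))) t<))

σ-at : ∀ a V i → σ a V (σpos V i) ≡ V i
σ-at a V zero = extend-block a (σ-grows a V) 0 1 (s≤s (s≤s z≤n))
σ-at a V (suc i) = trans (σ-block a V i (ε (V i) (V (suc i))) ≤-refl) (end (V i) (V (suc i)))
  where
  end : ∀ x y → nth a (σblock a x y) (ε x y) ≡ y
  end x y with x ≟ y
  ... | yes _ = refl
  ... | no  _ = refl

σ-gaps : ∀ {a V} → (∀ i → V i ≢ a) → Gaps (σ a V) a (σpos V) (λ i → ε (V i) (V (suc i)))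
σ-gaps {a} {V} a∉V = record
  { step = λ _ → refl
  ; keep = λ i e → a∉V i (trans (sym (σ-at a V i)) e)
  ; fill = λ i t t< → trans (σ-block a V i t (m≤n⇒m≤1+n t<)) (inner (V i) (V (suc i)) t t<) }
  where
  inner : ∀ x y t → t < ε x y → nth a (σblock a x y) t ≡ a
  inner x y t t< with x ≟ y
  inner x y zero          t< | yes _ = refl
  inner x y (suc zero)    t< | yes _ = refl
  inner x y (suc (suc t)) (s≤s (s≤s ())) | yes _
  inner x y zero          t< | no _  = refl
  inner x y (suc t)       (s≤s ()) | no _

-- Letters occurring in images under ψ and σ.

prefix-All : ∀ {Q : ℕ → Set} {V} → (∀ i → Q (V i)) → ∀ n → All Q (prefix V n)
prefix-All q n = All.map⁺ (All.applyUpTo⁺₂ _ n q)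

ψ-All : ∀ {Q : ℕ → Set} {a V} → Q a → (∀ i → Q (V i)) → ∀ i → Q (ψ a V i)
ψ-All {Q} {a} {V} qa q i = nth-All qa (go (prefix-All q (suc i))) i
  where
  go : ∀ {xs} → All Q xs → All Q (ψfin a xs)
  go [] = []
  go {x ∷ xs} (qx ∷ qs) with x ≟ a
  ... | yes _ = qa ∷ go qs
  ... | no  _ = qa ∷ qx ∷ go qs

σ-All : ∀ {Q : ℕ → Set} {a V} → Q a → (∀ i → Q (V i)) → ∀ i → Q (σ a V i)
σ-All {Q} {a} {V} qa q i = nth-All qa (qa ∷ go (V 0) _ (q 0) (All.map⁺ (All.applyUpTo⁺₂ _ i (λ j → q (suc j))))) i
  where
  go : ∀ x xs → Q x → All Q xs → All Q (σgo a x xs)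
  go x [] qx [] = qx ∷ []
  go x (y ∷ ys) qx (qy ∷ qs) with x ≟ y
  ... | yes _ = qx ∷ qa ∷ qa ∷ go y ys qy qs
  ... | no  _ = qx ∷ qa ∷ go y ys qy qs

-- Search for first and last positions.

least : ∀ {Q : ℕ → Set} → (∀ n → Dec (Q n)) → ∀ m d → Q (m + d) →
  ∃ λ n → m ≤ n × Q n × (∀ t → m ≤ t → t < n → ¬ Q t)
least {Q} Q? m d qd with Q? m
... | yes qm = m , ≤-refl , qm , λ t m≤t t<m _ → <⇒≱ t<m m≤t
least {Q} Q? m zero    qd | no ¬qm = ⊥-elim (¬qm (subst Q (+-identityʳ m) qd))
least {Q} Q? m (suc d) qd | no ¬qm with least Q? (suc m) d (subst Q (+-suc m d) qd)
... | n , m<n , qn , min = n , <⇒≤ m<n , qn , min′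
  where
  min′ : ∀ t → m ≤ t → t < n → ¬ Q t
  min′ t m≤t t<n with m≤n⇒m<n∨m≡n m≤t
  ... | inj₁ m<t  = min t m<t t<n
  ... | inj₂ refl = ¬qm

least-≥ : ∀ {Q : ℕ → Set} → (∀ n → Dec (Q n)) → ∀ {m p} → m ≤ p → Q p →
  ∃ λ n → m ≤ n × Q n × (∀ t → m ≤ t → t < n → ¬ Q t)
least-≥ {Q} Q? {m} m≤p qp with m≤n⇒∃[o]m+o≡n m≤p
... | d , refl = least Q? m d qp

greatest : ∀ {Q : ℕ → Set} → (∀ n → Dec (Q n)) → ∀ m d → Q m →
  ∃ λ n → m ≤ n × n ≤ m + d × Q n × (∀ t → n < t → t ≤ m + d → ¬ Q t)
greatest {Q} Q? m zero qm = m , ≤-refl , m≤m+n m 0 , qm ,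
  λ t m<t t≤ _ → <⇒≱ m<t (subst (t ≤_) (+-identityʳ m) t≤)
greatest {Q} Q? m (suc d) qm with Q? (m + suc d)
... | yes q = m + suc d , m≤m+n m _ , ≤-refl , q , λ t n<t t≤ _ → <⇒≱ n<t t≤
... | no ¬q with greatest Q? m d qm
... | n , m≤n , n≤ , qn , max = n , m≤n , ≤-trans n≤ (+-monoʳ-≤ m (n≤1+n d)) , qn , max′
  where
  max′ : ∀ t → n < t → t ≤ m + suc d → ¬ Q t
  max′ t n<t t≤ with m≤n⇒m<n∨m≡n t≤
  ... | inj₁ t<   = max t n<t (≤-pred (subst (suc t ≤_) (+-suc m d) t<))
  ... | inj₂ refl = ¬q

-- Deleting a letter

module _ {x : Word} {b : ℕ} {q f : ℕ → ℕ} (g : Gaps x b q f) where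
  open Gaps g

  gaps-< : ∀ i → q i < q (suc i)
  gaps-< i rewrite step i = s≤s (m≤m+n (q i) (f i))

  gaps-mono : ∀ i d → q i ≤ q (d + i)
  gaps-mono i zero    = ≤-refl
  gaps-mono i (suc d) = ≤-trans (gaps-mono i d) (<⇒≤ (gaps-< (d + i)))

  gaps-mono-≤ : ∀ {i j} → i ≤ j → q i ≤ q j
  gaps-mono-≤ {i} i≤j with m≤n⇒∃[o]m+o≡n i≤j
  ... | d , refl = subst (λ z → q i ≤ q z) (+-comm d i) (gaps-mono i d)

  gaps-mono-< : ∀ {i j} → i < j → q i < q j
  gaps-mono-< {i} i<j = <-≤-trans (gaps-< i) (gaps-mono-≤ i<j)

  gaps-cancel-< : ∀ {i j} → q i < q j → i < j
  gaps-cancel-< {i} {j} h with j ≤? i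
  ... | yes j≤i = ⊥-elim (<⇒≱ h (gaps-mono-≤ j≤i))
  ... | no  j≰i = ≰⇒> j≰i

  locate : ∀ N n → ∃ λ i → ∃ λ t → N ≤ i × t ≤ f i × q N + n ≡ q i + t
  locate N zero = N , 0 , ≤-refl , z≤n , refl
  locate N (suc n) with locate N n
  ... | i , t , N≤i , t≤ , e with m≤n⇒m<n∨m≡n t≤
  ... | inj₁ t<   = i , suc t , N≤i , t< , trans (+-suc (q N) n) (trans (cong suc e) (sym (+-suc (q i) t)))
  ... | inj₂ refl = suc i , 0 , m≤n⇒m≤1+n N≤i , z≤n ,
    trans (+-suc (q N) n) (trans (cong suc e) (trans (sym (step i)) (sym (+-identityʳ _))))

  locate-kept : ∀ {N p} → q N ≤ p → x p ≢ b → ∃ λ i → N ≤ i × q i ≡ p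
  locate-kept {N} {p} h ne with m≤n⇒∃[o]m+o≡n h
  ... | n , refl with locate N n
  ... | i , zero  , N≤i , _ , e = i , N≤i , sym (trans e (+-identityʳ _))
  ... | i , suc t , _   , t< , e = ⊥-elim (ne (trans (cong x (trans e (+-suc (q i) t))) (fill i t t<)))

  -- A run ends at the first letter other than `b`, and the window of agreement is just long enough
  -- to show that letter after `q i`.
  next-unique : ∀ i j → (∀ s → s ≤ suc (f i) → x (q j + s) ≡ x (q i + s)) → f j ≡ f i
  next-unique i j agree with <-cmp (f j) (f i)
  ... | tri≈ _ e _ = e
  ... | tri< h _ _ = ⊥-elim (keep (suc j) (trans (cong x (trans (step j) (sym (+-suc (q j) (f j)))))
          (trans (agree (suc (f j)) (≤-trans h (n≤1+n _))) (trans (cong x (+-suc (q i) (f j))) (fill i (f j) h)))))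
  ... | tri> _ _ h = ⊥-elim (keep (suc i) (trans (cong x (trans (step i) (sym (+-suc (q i) (f i)))))
          (trans (sym (agree (suc (f i)) ≤-refl)) (trans (cong x (+-suc (q j) (f i))) (fill j (f i) h)))))

-- Complete returns

record CR (y : Word) (i j : ℕ) : Set where
  field
    lt   : i < j
    same : y j ≡ y i
    none : ∀ t → i < t → t < j → y t ≢ y i

-- P records the positions that the letters of y have in the original word.
record Core (y : Word) (P : ℕ → ℕ) (A : List ℕ) : Set where
  field
    uniq : Unique A
    mem  : ∀ i → y i ∈ A
    occ  : ∀ {a} → a ∈ A → ∃ λ i → y i ≡ a
    rec  : ∀ i n m → ∃ λ p → m ≤ p ×
           (∀ t → t ≤ n → y (p + t) ≡ y (i + t) × P (p + t) + P i ≡ P (i + t) + P p)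
    pal  : ∀ {i j} → CR y i j → ∀ u v → u + v ≡ i + j → i ≤ u → i ≤ v →
           y u ≡ y v × P u + P v ≡ P i + P j
    bal  : ∀ {i j i′ j′} → CR y i j → CR y i′ j′ → y i ≡ y i′ → P j + P i′ ≤ suc (P j′ + P i)

module _ {y : Word} {P : ℕ → ℕ} {A : List ℕ} (c : Core y P A) where
  open Core c

  again : ∀ i m → ∃ λ p → m ≤ p × y p ≡ y i
  again i m with rec i 0 m
  ... | p , m≤p , h = p , m≤p ,
    trans (cong y (sym (+-identityʳ p))) (trans (proj₁ (h 0 z≤n)) (cong y (+-identityʳ i)))

  occ-≥ : ∀ {a} → a ∈ A → ∀ m → ∃ λ p → m ≤ p × y p ≡ a
  occ-≥ a∈A m with occ a∈A
  ... | i , refl = again i m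

  return : ∀ i → ∃ λ j → CR y i j
  return i with again i (suc i)
  ... | p , i<p , e with least-≥ (λ n → y n ≟ y i) i<p e
  ... | j , i<j , same , min = j , record { lt = i<j ; same = same ; none = min }

  -- The last `b` up to `t` exists because there is one at `i`; its return must end beyond `t`,
  -- since no later `b` lies at or before `t`.
  enclose : ∀ {i t b} → y i ≡ b → i ≤ t → y t ≢ b →
    ∃ λ i′ → ∃ λ j′ → CR y i′ j′ × y i′ ≡ b × i ≤ i′ × i′ < t × t < j′
  enclose {i} {t} {b} e i≤t ne with m≤n⇒∃[o]m+o≡n i≤t
  ... | d , refl with greatest (λ n → y n ≟ b) i d e
  ... | i′ , i≤i′ , i′≤t , e′ , max with return i′
  ... | j′ , cr = i′ , j′ , cr , e′ , i≤i′ , ≤∧≢⇒< i′≤t (λ { refl → ne e′ }) ,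
    ≰⇒> (λ j′≤t → max j′ (CR.lt cr) j′≤t (trans (CR.same cr) e′))

remove-letter : ∀ {A : List ℕ} {b} → Unique A → b ∈ A → ∃ λ A′ → length A ≡ suc (length A′) × Unique A′ ×
  (∀ {a} → a ∈ A → a ≢ b → a ∈ A′) × (∀ {a} → a ∈ A′ → a ∈ A × a ≢ b)
remove-letter {A = x ∷ xs} (x∉ ∷ u) (here refl) = xs , refl , u , sub , sup
  where
  sub : ∀ {a} → a ∈ x ∷ xs → a ≢ x → a ∈ xs
  sub (here e)  ne = ⊥-elim (ne e)
  sub (there h) ne = h
  sup : ∀ {a} → a ∈ xs → a ∈ x ∷ xs × a ≢ x
  sup h = there h , λ e → All.lookup x∉ h (sym e)
remove-letter {A = x ∷ xs} {b} (x∉ ∷ u) (there b∈) with remove-letter u b∈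
... | A′ , len , u′ , sub′ , sup′ = x ∷ A′ , cong suc len ,
      All.tabulate (λ h → All.lookup x∉ (proj₁ (sup′ h))) ∷ u′ , sub , sup
  where
  sub : ∀ {a} → a ∈ x ∷ xs → a ≢ b → a ∈ x ∷ A′
  sub (here e)  ne = here e
  sub (there h) ne = there (sub′ h ne)
  sup : ∀ {a} → a ∈ x ∷ A′ → a ∈ x ∷ xs × a ≢ b
  sup (here refl) = here refl , λ e → All.lookup x∉ b∈ e
  sup (there h)   = there (proj₁ (sup′ h)) , proj₂ (sup′ h)

module _ {y : Word} {P : ℕ → ℕ} {A : List ℕ} {b : ℕ} {q f : ℕ → ℕ} (c : Core y P A) (g : Gaps y b q f) where
  open Core c
  open Gaps g

  -- All occurrences of a letter other than `b` from `q 0` on survive the deletion, so none is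
  -- hidden between the two ends.
  return-lift : ∀ {i j} → CR (y ∘ q) i j → CR y (q i) (q j)
  return-lift {i} {j} cr = record { lt = gaps-mono-< g (CR.lt cr) ; same = CR.same cr ; none = none′ }
    where
    none′ : ∀ t → q i < t → t < q j → y t ≢ y (q i)
    none′ t qi<t t<qj e with locate-kept g (<⇒≤ qi<t) (λ e′ → keep i (trans (sym e) e′))
    ... | l , _ , refl = CR.none cr l (gaps-cancel-< g qi<t) (gaps-cancel-< g t<qj) e

  -- Induction from the left end: when `u` mirrors `suc v`, the run after `u` mirrors the run before
  -- `suc v`. Were their lengths different, the kept letter at the far end of the shorter run would
  -- be reflected onto a `b`.
  gaps-mirror : ∀ {i j} → CR (y ∘ q) i j → ∀ s v → (i + s) + v ≡ i + j → i ≤ v →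
    q (i + s) + q v ≡ q i + q j
  gaps-mirror {i} {j} cr zero v e i≤v rewrite +-identityʳ i | +-cancelˡ-≡ i v j e = refl
  gaps-mirror {i} {j} cr (suc s) v e i≤v = goal
    where
    u = i + s
    IH : q u + q (suc v) ≡ q i + q j
    IH = gaps-mirror cr s (suc v) (trans (+-suc u v) (trans (cong (_+ v) (sym (+-suc i s))) e)) (m≤n⇒m≤1+n i≤v)
    pal′ = pal (return-lift cr)
    i≤u : i ≤ u
    i≤u = m≤m+n i s
    f≡ : f u ≡ f v
    f≡ with <-cmp (f u) (f v)
    ... | tri≈ _ e′ _ = e′
    ... | tri> _ _ h = ⊥-elim (keep v (trans
            (proj₁ (pal′ (q v) (suc (q u + f v)) (trans (ring (q v) (q u) (f v)) (trans (cong (q u +_) (sym (step v))) IH))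
              (gaps-mono-≤ g i≤v) (m≤n⇒m≤1+n (≤-trans (gaps-mono-≤ g i≤u) (m≤m+n _ _)))))
            (fill u (f v) h)))
      where
      ring : ∀ a b d → a + suc (b + d) ≡ b + suc (a + d)
      ring = solve-∀
    ... | tri< h _ _ with m≤n⇒∃[o]m+o≡n h
    ... | o , eo = ⊥-elim (keep (suc u) (trans
            (proj₁ (pal′ (q (suc u)) (suc (q v + o))
              (trans (cong (_+ suc (q v + o)) (step u)) (trans (ring (q v) (q u) (f u) o (f v) eo) (trans (cong (q u +_) (sym (step v))) IH)))
              (gaps-mono-≤ g (m≤n⇒m≤1+n i≤u)) (m≤n⇒m≤1+n (≤-trans (gaps-mono-≤ g i≤v) (m≤m+n _ _)))))
            (fill v o (subst (o <_) eo (s≤s (m≤n+m o (f u)))))))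
      where
      ring : ∀ a b d o e → suc d + o ≡ e → suc (b + d) + suc (a + o) ≡ b + suc (a + e)
      ring a b d o e refl = ring′ a b d o
        where
        ring′ : ∀ a b d o → suc (b + d) + suc (a + o) ≡ b + suc (a + (suc d + o))
        ring′ = solve-∀
    goal : q (i + suc s) + q v ≡ q i + q j
    goal = trans (cong (λ z → q z + q v) (+-suc i s))
      (trans (cong (_+ q v) (trans (step u) (cong (λ z → suc (q u + z)) f≡)))
      (trans (ring (q u) (f v) (q v)) (trans (cong (q u +_) (sym (step v))) IH)))
      where
      ring : ∀ a b d → suc (a + b) + d ≡ a + suc (d + b)
      ring = solve-∀

  -- Run after run, `next-unique` applies because the agreement extends to the next kept letter.
  gaps-recur : ∀ i n p → (∀ t → q i + t ≤ q (i + n) → y (q p + t) ≡ y (q i + t)) →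
    ∀ t → t ≤ n → q (p + t) + q i ≡ q (i + t) + q p
  gaps-recur i n p agree zero _ rewrite +-identityʳ p | +-identityʳ i = +-comm (q p) (q i)
  gaps-recur i n p agree (suc t) t< with gaps-recur i n p agree t (<⇒≤ t<) | m≤n⇒∃[o]m+o≡n (gaps-mono-≤ g (m≤m+n i t))
  ... | IH | e , qe = goal
    where
    qe′ : q (p + t) ≡ q p + e
    qe′ = +-cancelʳ-≡ (q i) _ _ (trans IH (trans (cong (_+ q p) (sym qe)) (ring (q i) e (q p))))
      where
      ring : ∀ a e b → a + e + b ≡ b + e + a
      ring = solve-∀
    f≡ : f (p + t) ≡ f (i + t)
    f≡ = next-unique g (i + t) (p + t) λ s s≤ →
      trans (cong y (trans (cong (_+ s) qe′) (+-assoc (q p) e s)))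
      (trans (agree (e + s) (≤-trans (≤-reflexive (trans (sym (+-assoc (q i) e s)) (cong (_+ s) qe)))
               (≤-trans (+-monoʳ-≤ (q (i + t)) s≤) (≤-trans (≤-reflexive (trans (+-suc _ _) (sym (step (i + t)))))
                 (gaps-mono-≤ g (subst (_≤ i + n) (+-suc i t) (+-monoʳ-≤ i t<)))))))
             (cong y (trans (sym (+-assoc (q i) e s)) (cong (_+ s) qe))))
    goal : q (p + suc t) + q i ≡ q (i + suc t) + q p
    goal rewrite +-suc p t | +-suc i t | step (p + t) | step (i + t) | f≡ =
      cong suc (trans (ring (q (p + t)) (f (i + t)) (q i)) (trans (cong (_+ f (i + t)) IH) (sym (ring (q (i + t)) (f (i + t)) (q p)))))
      where
      ring : ∀ a b d → a + b + d ≡ a + d + b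
      ring = solve-∀

  -- The induction step on the alphabet. Returns lift to `y`, and original positions do not change,
  -- so `pal` and `bal` carry over. A window starting at a kept letter recurs at a kept letter, and
  -- `gaps-recur` keeps the later kept positions in step.
  core-delete : b ∈ A → ∃ λ A′ → length A ≡ suc (length A′) × Core (y ∘ q) (P ∘ q) A′
  core-delete b∈A with remove-letter uniq b∈A
  ... | A′ , len , u′ , sub , sup = A′ , len , record
    { uniq = u′
    ; mem  = λ i → sub (mem (q i)) (keep i)
    ; occ  = occ′
    ; rec  = rec′
    ; pal  = pal′
    ; bal  = λ cr cr′ e → bal (return-lift cr) (return-lift cr′) e }
    where
    occ′ : ∀ {a} → a ∈ A′ → ∃ λ i → y (q i) ≡ a
    occ′ a∈ with occ-≥ c (proj₁ (sup a∈)) (q 0)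
    ... | p , q0≤p , refl with locate-kept g q0≤p (proj₂ (sup a∈))
    ... | i , _ , refl = i , refl
    pal′ : ∀ {i j} → CR (y ∘ q) i j → ∀ u v → u + v ≡ i + j → i ≤ u → i ≤ v →
           y (q u) ≡ y (q v) × P (q u) + P (q v) ≡ P (q i) + P (q j)
    pal′ {i} cr u v e i≤u i≤v with m≤n⇒∃[o]m+o≡n i≤u
    ... | s , refl = pal (return-lift cr) (q u) (q v) (gaps-mirror cr s v e i≤v) (gaps-mono-≤ g i≤u) (gaps-mono-≤ g i≤v)
    rec′ : ∀ i n m → ∃ λ p → m ≤ p × (∀ t → t ≤ n →
           y (q (p + t)) ≡ y (q (i + t)) × P (q (p + t)) + P (q i) ≡ P (q (i + t)) + P (q p))
    rec′ i n m with m≤n⇒∃[o]m+o≡n (gaps-mono-≤ g (m≤m+n i n))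
    ... | D , eD with rec (q i) D (q m)
    ... | p , qm≤p , h with locate-kept g qm≤p (λ e → keep i (trans (cong y (sym (+-identityʳ (q i)))) (trans (sym (proj₁ (h 0 z≤n))) (trans (cong y (+-identityʳ p)) e))))
    ... | p′ , m≤p′ , refl = p′ , m≤p′ , both
      where
      agree : ∀ t → q i + t ≤ q (i + n) → y (q p′ + t) ≡ y (q i + t)
      agree t t≤ = proj₁ (h t (+-cancelˡ-≤ (q i) t D (subst (q i + t ≤_) (sym eD) t≤)))
      both : ∀ t → t ≤ n → y (q (p′ + t)) ≡ y (q (i + t)) × P (q (p′ + t)) + P (q i) ≡ P (q (i + t)) + P (q p′)
      both t t≤n with m≤n⇒∃[o]m+o≡n (gaps-mono-≤ g (m≤m+n i t))
      ... | e , qe = subst₂ (λ a d → y a ≡ y d × P a + P (q i) ≡ P d + P (q p′)) (sym qe′) qe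
                       (h e (+-cancelˡ-≤ (q i) e D (subst₂ _≤_ (sym qe) (sym eD) (gaps-mono-≤ g (+-monoʳ-≤ i t≤n)))))
        where
        qe′ : q (p′ + t) ≡ q p′ + e
        qe′ = +-cancelʳ-≡ (q i) _ _ (trans (gaps-recur i n p′ agree t t≤n) (trans (cong (_+ q p′) (sym qe)) (ring (q i) e (q p′))))
          where
          ring : ∀ a e b → a + e + b ≡ b + e + a
          ring = solve-∀

record Deletion (y : Word) (P : ℕ → ℕ) (b n : ℕ) : Set where
  field
    {q f} : ℕ → ℕ
    {A}   : List ℕ
    gaps  : Gaps y b q f
    f≥1   : ∀ i → 1 ≤ f i
    len   : n ≡ suc (length A)
    core  : Core (y ∘ q) (P ∘ q) A

-- The positions of letters other than `b` are found by search: `e` guarantees that there is always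
-- a next one, and the separation hypothesis that two of them are never adjacent, so runs are
-- nonempty.
delete : ∀ {y P A b e} → Core y P A → b ∈ A → e ∈ A → e ≢ b →
  (∀ t → y t ≡ b ⊎ y (suc t) ≡ b) →
  Deletion y P b (length A)
delete {y} {P} {A} {b} {e} c b∈ e∈ e≢b sep = record
  { gaps = g ; f≥1 = f≥1 ; len = proj₁ (proj₂ del) ; core = proj₂ (proj₂ del) }
  where
  open Core c
  next : ∀ m → ∃ λ n → m ≤ n × y n ≢ b × (∀ t → m ≤ t → t < n → ¬ (y t ≢ b))
  next m with occ-≥ c e∈ m
  ... | p , m≤p , refl = least-≥ (λ n → ¬? (y n ≟ b)) m≤p e≢b
  q : ℕ → ℕ
  q zero    = proj₁ (next 0)
  q (suc i) = proj₁ (next (suc (q i)))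
  f : ℕ → ℕ
  f i = q (suc i) ∸ suc (q i)
  keep : ∀ i → y (q i) ≢ b
  keep zero    = proj₁ (proj₂ (proj₂ (next 0)))
  keep (suc i) = proj₁ (proj₂ (proj₂ (next (suc (q i)))))
  q< : ∀ i → q i < q (suc i)
  q< i = proj₁ (proj₂ (next (suc (q i))))
  g : Gaps y b q f
  g = record
    { step = λ i → sym (m+[n∸m]≡n (q< i))
    ; keep = keep
    ; fill = λ i t t< → decidable-stable (y _ ≟ b)
        (proj₂ (proj₂ (proj₂ (next (suc (q i))))) (suc (q i + t)) (s≤s (m≤m+n (q i) t))
          (≤-trans (+-monoʳ-< (suc (q i)) t<) (≤-reflexive (m+[n∸m]≡n (q< i))))) }
  f≥1 : ∀ i → 1 ≤ f i
  f≥1 i with sep (q i)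
  ... | inj₁ h = ⊥-elim (keep i h)
  ... | inj₂ h = m<n⇒0<n∸m (≤∧≢⇒< (q< i) (λ eq → keep (suc i) (trans (cong y (sym eq)) h)))
  del = core-delete c g b∈

-- Inequalities, centres of palindromes, recurrence of adjacent pairs.

absurd-≤ : ∀ {l r} x → l ≤ r → l ≡ suc (r + x) → ⊥
absurd-≤ {l} {r} x l≤r e = <⇒≱ (subst (r <_) (sym e) (s≤s (m≤m+n r x))) l≤r

cancel-≤ : ∀ {l r a b} x → l ≤ r → l ≡ a + x → r ≡ b + x → a ≤ b
cancel-≤ x l≤r refl refl = +-cancelʳ-≤ x _ _ l≤r

-- The lengths compared are `3 + s * L`, of at least three steps, and `1 + 2 * L`, of a square of
-- weight 2. They differ by at least 2, whereas balance allows 1.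
too-long : ∀ {p₃ i₁} p i s L → p₃ ≡ 3 + p + s * L → i₁ ≡ suc (i + 2 * L) → 2 ≤ s → p₃ + i ≤ suc (i₁ + p) → ⊥
too-long p i s L refl refl 2≤s h = absurd-≤ 0 (+-mono-≤ h (*-monoˡ-≤ L 2≤s)) (r p i s L)
  where
  r : ∀ p i s L → 3 + p + s * L + i + 2 * L ≡ suc (suc (suc (i + 2 * L) + p) + s * L + 0)
  r = solve-∀

halve : ∀ n → ∃ λ e → n ≡ e + e ⊎ n ≡ suc (e + e)
halve zero = 0 , inj₁ refl
halve (suc n) with halve n
... | e , inj₁ h = e , inj₂ (cong suc h)
... | e , inj₂ h = suc e , inj₁ (trans (cong suc h) (cong suc (sym (+-suc e e))))

-- The parity of the length decides: an even palindrome has two equal letters in the middle, an odd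
-- one has the form `aba` there, with a square if the middle letter is also `a`. The letter found
-- need not be the one that returns.
center : ∀ {y P A i j} → Core y P A → CR y i j → (∃ λ m → y m ≡ y (suc m)) ⊎ (∃ λ m → CR y m (2 + m))
center {y} {i = i} {j} c cr with m≤n⇒∃[o]m+o≡n (CR.lt cr)
... | o , e with halve o
... | h , inj₁ refl = inj₁ (i + h , proj₁ (Core.pal c cr (i + h) (suc (i + h))
        (trans (ring i h) (cong (i +_) e)) (m≤m+n i h) (m≤n⇒m≤1+n (m≤m+n i h))))
  where
  ring : ∀ i h → i + h + suc (i + h) ≡ i + (suc i + (h + h))
  ring = solve-∀
... | h , inj₂ refl with y (suc (i + h)) ≟ y (i + h)
... | yes s = inj₁ (i + h , sym s)
... | no ns = inj₂ (i + h , record { lt = n≤1+n _ ; same = sym same ; none = none })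
  where
  ring : ∀ i h → i + h + suc (suc (i + h)) ≡ i + (suc i + suc (h + h))
  ring = solve-∀
  same : y (i + h) ≡ y (2 + (i + h))
  same = proj₁ (Core.pal c cr (i + h) (2 + (i + h)) (trans (ring i h) (cong (i +_) e)) (m≤m+n i h)
    (≤-trans (m≤m+n i h) (m≤n+m (i + h) 2)))
  none : ∀ t → i + h < t → t < 2 + (i + h) → y t ≢ y (i + h)
  none t lo (s≤s hi) e′ = ns (trans (cong y (≤-antisym lo hi)) e′)

square-return : ∀ {y : Word} {i} → y i ≡ y (suc i) → CR y i (suc i)
square-return e = record { lt = ≤-refl ; same = sym e ; none = λ t lo hi _ → <⇒≱ hi lo }

pair-again : ∀ {y P A} → Core y P A → ∀ i m → ∃ λ p → m ≤ p × y p ≡ y i × y (suc p) ≡ y (suc i) ×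
  P (suc p) + P i ≡ P (suc i) + P p
pair-again {y} {P} c i m with Core.rec c i 1 m
... | p , m≤p , h = p , m≤p ,
  trans (cong y (sym (+-identityʳ p))) (trans (proj₁ (h 0 z≤n)) (cong y (+-identityʳ i))) ,
  subst₂ (λ a b → y a ≡ y b) (+-comm p 1) (+-comm i 1) (proj₁ (h 1 ≤-refl)) ,
  subst₂ (λ a b → P a + P i ≡ P b + P p) (+-comm p 1) (+-comm i 1) (proj₂ (h 1 ≤-refl))

-- Only beyond `i₀` is a position known to lie in a return to that letter, so the pair is first
-- moved there by recurrence. In a return of at most two steps it then contains an end.
separating : ∀ {y P A i₀} → Core y P A → (∀ {i j} → CR y i j → y i ≡ y i₀ → j ≤ 2 + i) →
  ∀ t → y t ≡ y i₀ ⊎ y (suc t) ≡ y i₀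
separating {y} {i₀ = i₀} c short t with pair-again c t i₀
... | p , i₀≤p , e₀ , e₁ , _ with y p ≟ y i₀
... | yes e = inj₁ (trans (sym e₀) e)
... | no ne with enclose c refl i₀≤p ne
... | i′ , j′ , cr , e′ , _ , i′<p , p<j′ = inj₂ (trans (sym e₁) (trans (cong y j′≡) (trans (CR.same cr) e′)))
  where
  j′≡ : suc p ≡ j′
  j′≡ = ≤-antisym p<j′ (≤-trans (short cr e′) (s≤s i′<p))

-- Words with weighted gaps.

-- Between the letters y i and y (suc i), the original word has f i copies of a block of
-- length suc l. The field fbal says that two sums of equally many consecutive
-- values of f never differ by exactly 2.
record Weighted (l : ℕ) (y : Word) (f P : ℕ → ℕ) (A : List ℕ) : Set where
  field
    core  : Core y P A
    f≥1   : ∀ i → 1 ≤ f i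
    f≤    : ∀ i j → f i ≤ suc (f j)
    stepP : ∀ i → P (suc i) ≡ suc (P i + f i * suc l)
    fbal  : ∀ i i′ d → P (d + i) + P i′ ≢ P (d + i′) + P i + (suc l + suc l)

module _ {l : ℕ} {y : Word} {f P : ℕ → ℕ} {A : List ℕ} (W : Weighted l y f P A) where
  open Weighted W
  open Core core

  P-mono : ∀ i d → P i ≤ P (d + i)
  P-mono i zero    = ≤-refl
  P-mono i (suc d) rewrite stepP (d + i) = m≤n⇒m≤1+n (≤-trans (P-mono i d) (m≤m+n _ _))

  P-two : ∀ i → P (2 + i) ≡ 2 + P i + (f i + f (1 + i)) * suc l
  P-two i = trans (stepP (suc i)) (trans (cong (λ z → suc (z + f (suc i) * suc l)) (stepP i)) (r (P i) (f i) (f (suc i)) (suc l)))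
    where
    r : ∀ p a b L → suc (suc (p + a * L) + b * L) ≡ 2 + p + (a + b) * L
    r = solve-∀

  P-three : ∀ i → P (3 + i) ≡ 3 + P i + (f i + f (1 + i) + f (2 + i)) * suc l
  P-three i = trans (stepP (2 + i)) (trans (cong (λ z → suc (z + f (2 + i) * suc l)) (P-two i)) (r (P i) (f i + f (suc i)) (f (2 + i)) (suc l)))
    where
    r : ∀ p a b L → suc (2 + p + a * L + b * L) ≡ 3 + p + (a + b) * L
    r = solve-∀

  P-four : ∀ i → P (4 + i) ≡ 4 + P i + (f i + f (1 + i) + (f (2 + i) + f (3 + i))) * suc l
  P-four i = trans (P-two (2 + i)) (trans (cong (λ z → 2 + z + (f (2 + i) + f (3 + i)) * suc l) (P-two i)) (r (P i) (f i + f (suc i)) (f (2 + i) + f (3 + i)) (suc l)))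
    where
    r : ∀ p a b L → 2 + (2 + p + a * L) + b * L ≡ 4 + p + (a + b) * L
    r = solve-∀

  weight-again : ∀ {p i} → P (suc p) + P i ≡ P (suc i) + P p → f p ≡ f i
  weight-again {p} {i} e = *-cancelʳ-≡ (f p) (f i) (suc l) (arith (P p) (P i) (f p * suc l) (f i * suc l) (stepP p) (stepP i) e)
    where
    arith : ∀ {p1 i1} p i a b → p1 ≡ suc (p + a) → i1 ≡ suc (i + b) → p1 + i ≡ i1 + p → a ≡ b
    arith p i a b refl refl e = +-cancelˡ-≡ (suc (p + i)) a b (trans (sym (r₁ p i a)) (trans e (r₂ p i b)))
      where
      r₁ : ∀ p i a → suc (p + a) + i ≡ suc (p + i) + a
      r₁ = solve-∀
      r₂ : ∀ p i b → suc (i + b) + p ≡ suc (p + i) + b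
      r₂ = solve-∀

  weight-mirror : ∀ {i} → CR y i (2 + i) → f (suc i) ≡ f i
  weight-mirror {i} cr = weight-again
    (trans (+-comm _ (P i)) (sym (proj₂ (pal cr (suc i) (suc i) (sym (+-suc i (suc i))) (n≤1+n i) (n≤1+n i)))))

  -- Weights in the absence of squares.

  module _ (nosq : ∀ i → y i ≢ y (suc i)) where

    P-even : ∀ {i} → CR y i (2 + i) → P (2 + i) ≡ 2 + P i + (f i + f i) * suc l
    P-even {i} cr = trans (P-two i) (cong (λ z → 2 + P i + (f i + z) * suc l) (weight-mirror cr))

    -- A larger weight would lengthen the return by at least `2 * suc l`, hence by at least 2,
    -- against balance.
    weight-≤ : ∀ {i m} → CR y i (2 + i) → CR y m (2 + m) → y i ≡ y m → f i ≤ f m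
    weight-≤ {i} {m} cr cr′ e = ≮⇒≥ λ h →
      absurd-≤ (l + l) (+-mono-≤ (subst₂ (λ a b → a + P m ≤ suc (b + P i)) (P-even cr) (P-even cr′) (bal cr cr′ e))
                                 (*-monoˡ-≤ (suc l) (+-mono-≤ h h)))
        (r (P i) (P m) (f i) (f m) l)
      where
      r : ∀ p q a b l → 2 + p + (a + a) * suc l + q + (suc b + suc b) * suc l ≡
          suc (suc (2 + q + (b + b) * suc l + p) + (a + a) * suc l + (l + l))
      r = solve-∀

    -- One step is a square, and three steps have a square at the centre. Four or more steps carry
    -- at least four weights; two consecutive weights add up to at least `f m`, so the return would
    -- exceed the one at `m` by at least 2.
    return-two : ∀ {m i j} → CR y m (2 + m) → CR y i j → y i ≡ y m → j ≡ 2 + i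
    return-two {m} {i} {j} crm cr e with m≤n⇒∃[o]m+o≡n (CR.lt cr)
    ... | zero , e′ = ⊥-elim (nosq i (sym (trans (cong y (trans (cong suc (sym (+-identityʳ i))) e′)) (CR.same cr))))
    ... | suc zero , e′ = sym (trans (cong suc (+-comm 1 i)) e′)
    ... | suc (suc zero) , e′ = ⊥-elim (nosq (suc i) (proj₁ (pal cr (1 + i) (2 + i)
            (trans (r i) (cong (i +_) e′)) (n≤1+n i) (m≤n+m i 2))))
      where
      r : ∀ i → 1 + i + (2 + i) ≡ i + (suc i + 2)
      r = solve-∀
    ... | suc (suc (suc o)) , e′ = ⊥-elim (absurd-≤ 0
            (+-mono-≤ (subst₂ (λ a b → a + P m ≤ suc (b + P i)) refl (P-even crm)
                        (≤-trans (+-monoˡ-≤ (P m) (subst₂ _≤_ (P-four i) (cong P (trans (r′ o i) e′)) (P-mono (4 + i) o)))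
                                 (bal cr crm e)))
                      (*-monoˡ-≤ (suc l) (+-mono-≤ (half i) (half (2 + i)))))
            (r (P i) (P m) (f m) (f i + f (1 + i) + (f (2 + i) + f (3 + i))) (suc l)))
      where
      r′ : ∀ o i → o + (4 + i) ≡ suc i + suc (suc (suc o))
      r′ = solve-∀
      half : ∀ t → f m ≤ f t + f (suc t)
      half t = ≤-trans (f≤ m (suc t)) (+-monoˡ-≤ (f (suc t)) (f≥1 t))
      r : ∀ p q n s L → 4 + p + s * L + q + (n + n) * L ≡ suc (suc (2 + q + (n + n) * L + p) + s * L + 0)
      r = solve-∀

    -- The centre of any return supplies a letter with a return of two steps. Then all its returns
    -- are such, so every adjacent pair from `m` on is half of one, and all halves weigh the same.
    -- Earlier pairs recur later.
    weight-constant : ∃ λ n → ∀ t → f t ≡ n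
    weight-constant with center core (proj₂ (return core 0))
    ... | inj₁ (m , e) = ⊥-elim (nosq m e)
    ... | inj₂ (m , crm) = f m , all
      where
      both : ∀ {i j} → CR y i j → y i ≡ y m → f i ≡ f m × f (suc i) ≡ f m
      both cr e with return-two crm cr e
      ... | refl = ≤-antisym (weight-≤ cr crm e) (weight-≤ crm cr (sym e)) ,
                   trans (weight-mirror cr) (≤-antisym (weight-≤ cr crm e) (weight-≤ crm cr (sym e)))
      from : ∀ t → m ≤ t → f t ≡ f m
      from t m≤t with y t ≟ y m
      ... | yes e = proj₁ (both (proj₂ (return core t)) e)
      ... | no ne with enclose core refl m≤t ne
      ... | i′ , j′ , cr , e′ , _ , i′<t , t<j′ =
        trans (cong f (≤-antisym (≤-pred (subst (t <_) (return-two crm cr e′) t<j′)) i′<t)) (proj₂ (both cr e′))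
      all : ∀ t → f t ≡ f m
      all t with pair-again core t m
      ... | p , m≤p , _ , _ , eP = trans (sym (weight-again eP)) (from p m≤p)

  -- Weights in the presence of a square.

  private
    arith-two : ∀ u i c → 2 + u + c + i ≡ c + (2 + u + i)
    arith-two = solve-∀
    arith-one : ∀ u i c → suc (suc (i + c) + u) ≡ c + (2 + u + i)
    arith-one = solve-∀
    arith-skip : ∀ o u → o + (3 + u) ≡ 2 + u + suc o
    arith-skip = solve-∀
    arith-skip′ : ∀ o u → o + (3 + u) ≡ suc u + suc (suc o)
    arith-skip′ = solve-∀

  -- These are the exponents of σ, 2 inside a square and 1 elsewhere, together with the fact that
  -- `b` meets every pair and `bb` is the only possible square.
  data Edge (b t : ℕ) : Set where
    single : f t ≡ 1 → y t ≢ y (suc t) → y t ≡ b ⊎ y (suc t) ≡ b → Edge b t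
    double : f t ≡ 2 → y t ≡ b → y (suc t) ≡ b → Edge b t

  module _ {i : ℕ} (sq : y i ≡ y (suc i)) {e : ℕ} (e∈A : e ∈ A) (e≢ : e ≢ y i) where

    -- Since `e` occurs beyond `i`, some return to `y i` takes at least two steps. Balance against
    -- the square gives `f u + f (suc u) ≤ f i`, while `f i` exceeds neither weight by more than 1.
    -- As weights are positive, only 1 + 1 = 2 is left.
    square-weight : f i ≡ 2 × ∃ λ u → CR y u (2 + u) × y u ≡ y i × f u ≡ 1 × f (suc u) ≡ 1
    square-weight with occ-≥ core e∈A i
    ... | t , i≤t , refl with enclose core refl i≤t e≢
    ... | u , v , cr , eu , _ , u<t , t<v with m≤n⇒∃[o]m+o≡n (≤-trans (s≤s u<t) t<v)
    ... | o , ev = fi , u , cr′ , eu , fu , fu′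
      where
      h : P (2 + u) + P i ≤ suc (P (suc i) + P u)
      h = ≤-trans (+-monoˡ-≤ (P i) (subst (λ z → P (2 + u) ≤ P z) (trans (+-comm o (2 + u)) ev) (P-mono (2 + u) o)))
                  (bal cr (square-return sq) eu)
      sum≤ : f u + f (suc u) ≤ f i
      sum≤ = *-cancelʳ-≤ (f u + f (suc u)) (f i) (suc l)
        (cancel-≤ (2 + P u + P i) h (trans (cong (_+ P i) (P-two u)) (arith-two (P u) (P i) ((f u + f (suc u)) * suc l)))
                                    (trans (cong (λ z → suc (z + P u)) (stepP i)) (arith-one (P u) (P i) (f i * suc l))))
      fu′ : f (suc u) ≡ 1
      fu′ = ≤-antisym (+-cancelˡ-≤ (f u) (f (suc u)) 1 (≤-trans sum≤ (≤-trans (f≤ i u) (≤-reflexive (+-comm 1 (f u)))))) (f≥1 _)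
      fu : f u ≡ 1
      fu = ≤-antisym (+-cancelʳ-≤ (f (suc u)) (f u) 1 (≤-trans sum≤ (f≤ i (suc u)))) (f≥1 _)
      fi : f i ≡ 2
      fi = ≤-antisym (subst (λ z → f i ≤ suc z) fu (f≤ i u)) (subst₂ (λ a b → a + b ≤ f i) fu fu′ sum≤)
      o≡0 : ∀ o → 2 + u + o ≡ v → o ≡ 0
      o≡0 zero     _   = refl
      o≡0 (suc o′) ev′ = ⊥-elim (too-long (P u) (P i) (f u + f (suc u) + f (2 + u)) (suc l) (P-three u)
          (trans (stepP i) (cong (λ z → suc (P i + z * suc l)) fi)) (≤-trans (+-mono-≤ (f≥1 u) (f≥1 (suc u))) (m≤m+n _ _))
          (≤-trans (+-monoˡ-≤ (P i) (subst (λ z → P (3 + u) ≤ P z) (trans (arith-skip o′ u) ev′) (P-mono (3 + u) o′)))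
                   (bal cr (square-return sq) eu)))
      cr′ : CR y u (2 + u)
      cr′ = subst (CR y u) (sym (trans (sym (+-identityʳ (2 + u))) (trans (cong (2 + u +_) (sym (o≡0 o ev))) ev))) cr

    weights≤2 : ∀ t → f t ≤ 2
    weights≤2 t with square-weight
    ... | _ , u , _ , _ , fu , _ = subst (λ z → f t ≤ suc z) fu (f≤ t u)

    -- A one-step return is at most 1 shorter than the return at `u`, hence weighs 2. A two-step
    -- return is at most 1 longer than the square at `i`, hence has weights 1 and 1. More steps are
    -- excluded by `too-long`.
    returns : ∀ {p s} → CR y p s → y p ≡ y i → (s ≡ suc p × f p ≡ 2) ⊎ (s ≡ 2 + p × f p ≡ 1 × f (suc p) ≡ 1)
    returns {p} {s} cr ep with square-weight | m≤n⇒∃[o]m+o≡n (CR.lt cr)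
    ... | fi , u , cru , eu , fu , fu′ | zero , e′ with trans (sym e′) (cong suc (+-identityʳ p))
    ... | refl = inj₁ (refl , ≤-antisym (weights≤2 p) (*-cancelʳ-≤ 2 (f p) (suc l)
            (cancel-≤ (2 + P u + P p) (bal cru cr (trans eu (sym ep)))
              (trans (cong (_+ P p) (trans (P-two u) (cong₂ (λ a b → 2 + P u + (a + b) * suc l) fu fu′))) (arith-two (P u) (P p) (2 * suc l)))
              (trans (cong (λ z → suc (z + P u)) (stepP p)) (arith-one (P u) (P p) (f p * suc l))))))
    returns {p} {s} cr ep | fi , u , cru , eu , fu , fu′ | suc zero , e′ with trans (sym e′) (cong suc (+-comm p 1))
    ... | refl = inj₂ (refl , ≤-antisym (+-cancelʳ-≤ 1 (f p) 1 (≤-trans (+-monoʳ-≤ (f p) (f≥1 (suc p))) sum≤)) (f≥1 p) ,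
                       ≤-antisym (+-cancelˡ-≤ 1 (f (suc p)) 1 (≤-trans (+-monoˡ-≤ (f (suc p)) (f≥1 p)) sum≤)) (f≥1 (suc p)))
      where
      sum≤ : f p + f (suc p) ≤ 2
      sum≤ = *-cancelʳ-≤ (f p + f (suc p)) 2 (suc l)
        (cancel-≤ (2 + P p + P i) (bal cr (square-return sq) ep)
          (trans (cong (_+ P i) (P-two p)) (arith-two (P p) (P i) ((f p + f (suc p)) * suc l)))
          (trans (cong (λ z → suc (z + P p)) (trans (stepP i) (cong (λ z → suc (P i + z * suc l)) fi))) (arith-one (P p) (P i) (2 * suc l))))
    returns {p} {s} cr ep | fi , u , cru , eu , fu , fu′ | suc (suc o) , e′ = ⊥-elim
      (too-long (P p) (P i) (f p + f (suc p) + f (2 + p)) (suc l) (P-three p)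
        (trans (stepP i) (cong (λ z → suc (P i + z * suc l)) fi)) (≤-trans (+-mono-≤ (f≥1 p) (f≥1 (suc p))) (m≤m+n _ _))
        (≤-trans (+-monoˡ-≤ (P i) (subst (λ z → P (3 + p) ≤ P z) (trans (arith-skip′ o p) e′) (P-mono (3 + p) o)))
                 (bal cr (square-return sq) ep)))

    edges-from : ∀ t → i ≤ t → Edge (y i) t
    edges-from t i≤t with y t ≟ y i
    edges-from t i≤t | yes et with return core t
    ... | j , cr with returns cr et
    ... | inj₁ (refl , ft) = double ft et (trans (CR.same cr) et)
    ... | inj₂ (refl , ft , _) = single ft (λ e′ → CR.none cr (suc t) ≤-refl ≤-refl (sym e′)) (inj₁ et)
    edges-from t i≤t | no ne with enclose core refl i≤t ne
    ... | u , v , cr , eu , _ , u<t , t<v with returns cr eu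
    ... | inj₁ (refl , _) = ⊥-elim (<⇒≱ t<v u<t)
    ... | inj₂ (refl , _ , fu′) with ≤-antisym u<t (≤-pred t<v)
    ... | refl = single fu′ (λ e′ → ne (trans e′ (trans (CR.same cr) eu))) (inj₂ (trans (CR.same cr) eu))

    edges : ∀ t → Edge (y i) t
    edges t with pair-again core t i
    ... | p , i≤p , e₀ , e₁ , eP with edges-from p i≤p
    ... | single fp ne (inj₁ h) = single (trans (sym (weight-again eP)) fp) (λ e′ → ne (trans e₀ (trans e′ (sym e₁)))) (inj₁ (trans (sym e₀) h))
    ... | single fp ne (inj₂ h) = single (trans (sym (weight-again eP)) fp) (λ e′ → ne (trans e₀ (trans e′ (sym e₁)))) (inj₂ (trans (sym e₁) h))
    ... | double fp h₀ h₁ = double (trans (sym (weight-again eP)) fp) (trans (sym e₀) h₀) (trans (sym e₁) h₁)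

-- Descent: deleting the letter of the square.

module _ {l : ℕ} {y : Word} {f P : ℕ → ℕ} {A A′ : List ℕ} {b : ℕ} {q f′ : ℕ → ℕ}
  (W : Weighted l y f P A) (edge : ∀ t → Edge W b t) (g : Gaps y b q f′) (f′≥1 : ∀ i → 1 ≤ f′ i)
  (core′ : Core (y ∘ q) (P ∘ q) A′) where
  open Weighted W
  open Gaps g

  private
    L = suc l

  leave : ∀ {t} → y t ≢ b → P (suc t) ≡ suc (P t + L)
  leave {t} ne with edge t
  ... | double _ e _ = ⊥-elim (ne e)
  ... | single e _ _ = trans (stepP t) (cong (λ z → suc (P t + z)) (trans (cong (_* L) e) (*-identityˡ L)))

  enter : ∀ {t} → y (suc t) ≢ b → P (suc t) ≡ suc (P t + L)
  enter {t} ne with edge t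
  ... | double _ _ e = ⊥-elim (ne e)
  ... | single e _ _ = trans (stepP t) (cong (λ z → suc (P t + z)) (trans (cong (_* L) e) (*-identityˡ L)))

  stay : ∀ {t} → y t ≡ b → y (suc t) ≡ b → P (suc t) ≡ suc (P t + (L + L))
  stay {t} e₀ e₁ with edge t
  ... | single _ ne _ = ⊥-elim (ne (trans e₀ (sym e₁)))
  ... | double e _ _ = trans (stepP t) (cong (λ z → suc (P t + z)) (trans (cong (_* L) e) (cong (L +_) (*-identityˡ L))))

  run : ∀ i s → s < f′ i → P (suc (q i + s)) ≡ suc (P (q i) + L) + s * suc (L + L)
  run i zero    _  = trans (cong (P ∘ suc) (+-identityʳ (q i))) (trans (leave (keep i)) (sym (+-identityʳ _)))
  run i (suc s) s< = trans (cong (P ∘ suc) (+-suc (q i) s))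
    (trans (stay (fill i s (<⇒≤ s<)) (trans (cong (y ∘ suc) (sym (+-suc (q i) s))) (fill i (suc s) s<)))
    (trans (cong (λ z → suc (z + (L + L))) (run i s (<⇒≤ s<))) (r (P (q i)) L (s * suc (L + L)))))
    where
    r : ∀ p L x → suc (suc (p + L) + x + (L + L)) ≡ suc (p + L) + (suc (L + L) + x)
    r = solve-∀

  next-keep : ∀ i → y (suc (q i + f′ i)) ≢ b
  next-keep i = subst (λ z → y z ≢ b) (step i) (keep (suc i))

  -- With `B` the block of length `L`, a run of letters `b` reads `B b BB b BB ... b B` in the
  -- original word: the block `B b B`, of length `suc (L + L)`, once for each `b`.
  stepP′ : ∀ i → P (q (suc i)) ≡ suc (P (q i) + f′ i * suc (L + L))
  stepP′ i with m≤n⇒∃[o]m+o≡n (f′≥1 i)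
  ... | s , e = trans (cong P (step i)) (trans (enter (next-keep i))
      (trans (cong (λ z → suc (z + L)) (trans (cong P (trans (cong (q i +_) (sym e)) (+-suc (q i) s))) (run i s (≤-reflexive e))))
      (trans (r (P (q i)) L (s * suc (L + L))) (cong (λ z → suc (P (q i) + z * suc (L + L))) e))))
    where
    r : ∀ p L x → suc (suc (p + L) + x + L) ≡ suc (p + (suc (L + L) + x))
    r = solve-∀

  -- In `bbb` two consecutive weights are 2 and 2, whereas the two weights around the next kept
  -- letter are 1 and 1. This is the difference that `fbal` forbids.
  at-most-two : ∀ i → f′ i ≤ 2
  at-most-two i = ≮⇒≥ λ 3≤ → fbal (suc (q i + 0)) (q i + f′ i) 2
    (trans (cong (_+ P (q i + f′ i)) (trans (cong (P ∘ suc) (sym (trans (+-suc (q i) 1) (cong suc (+-suc (q i) 0))))) (run i 2 3≤)))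
    (trans (r (P (q i)) L (P (q i + f′ i)))
    (sym (cong₂ (λ u v → u + v + (L + L)) out (run i 0 (<-trans (s≤s z≤n) 3≤))))))
    where
    out : P (2 + (q i + f′ i)) ≡ suc (suc (P (q i + f′ i) + L) + L)
    out = trans (leave (next-keep i)) (cong (λ z → suc (z + L)) (enter (next-keep i)))
    r : ∀ p L u → suc (p + L) + 2 * suc (L + L) + u ≡ suc (suc (u + L) + L) + (suc (p + L) + 0 * suc (L + L)) + (L + L)
    r = solve-∀

  -- Let F be the sum of `d` consecutive weights `f′` and M = `suc (L + L)`. Over these steps `P`
  -- grows by `d + F * M` and `q` by `d + F`; eliminating F gives the identity, written without
  -- subtraction.
  closed-form : ∀ i d → P (q (d + i)) + d * suc (L + L) + suc (L + L) * q i ≡ P (q i) + d + suc (L + L) * q (d + i)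
  closed-form i zero = refl
  closed-form i (suc d) = trans
    (cong (λ z → z + suc d * suc (L + L) + suc (L + L) * q i) (stepP′ (d + i)))
    (trans (r₁ (P (q (d + i))) (f′ (d + i)) (suc (L + L)) d (q i))
    (trans (cong (λ z → suc (z + suc (f′ (d + i)) * suc (L + L))) (closed-form i d))
    (trans (r₂ (P (q i)) d (suc (L + L)) (q (d + i)) (f′ (d + i)))
      (cong (λ z → P (q i) + suc d + suc (L + L) * z) (sym (step (d + i)))))))
    where
    r₁ : ∀ p f M d x → suc (p + f * M) + suc d * M + M * x ≡ suc (p + d * M + M * x + suc f * M)
    r₁ = solve-∀
    r₂ : ∀ p d M x f → suc (p + d + M * x + suc f * M) ≡ p + suc d + M * suc (x + f)
    r₂ = solve-∀

  q-diff : ∀ i i′ d → P (q (d + i)) + P (q i′) ≡ P (q (d + i′)) + P (q i) + (suc (L + L) + suc (L + L)) →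
    q (d + i) + q i′ ≡ 2 + (q (d + i′) + q i)
  q-diff i i′ d h = *-cancelˡ-≡ _ _ (suc (L + L)) (+-cancelˡ-≡ (P (q i) + d + (P (q (d + i′)) + d * M)) _ _
    (trans (r₁ (P (q i) + d) (P (q (d + i′)) + d * M) M (q (d + i)) (q i′))
    (trans (cong₂ _+_ (sym (closed-form i d)) (closed-form i′ d))
    (trans (r₂ (P (q (d + i))) (P (q i′)) d M (q i) (q (d + i′)))
    (trans (cong (λ z → z + d * M + M * q i + (d + M * q (d + i′))) h)
           (r₃ (P (q (d + i′))) (P (q i)) d M (q i) (q (d + i′))))))))
    where
    M = suc (L + L)
    r₁ : ∀ a b M u v → a + b + M * (u + v) ≡ (a + M * u) + (b + M * v)
    r₁ = solve-∀
    r₂ : ∀ p p′ d M u v → (p + d * M + M * u) + (p′ + d + M * v) ≡ p + p′ + d * M + M * u + (d + M * v)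
    r₂ = solve-∀
    r₃ : ∀ p p′ d M u v → p + p′ + (M + M) + d * M + M * u + (d + M * v) ≡ p′ + d + (p + d * M) + M * (2 + (v + u))
    r₃ = solve-∀

  -- Otherwise one stretch of `y` would be exactly two steps longer than the other. Dropping its
  -- first and last step, both of weight 1, leaves equally many steps whose weights still differ by
  -- 2 in sum.
  fbal′ : ∀ i i′ d → P (q (d + i)) + P (q i′) ≢ P (q (d + i′)) + P (q i) + (suc (L + L) + suc (L + L))
  fbal′ i i′ d h with m≤n⇒∃[o]m+o≡n (gaps-mono g i′ d)
  ... | D , eD = fbal (suc (q i)) (q i′) D
      (+-cancelˡ-≡ (suc L) _ _ (trans (r₁ (P (D + suc (q i))) L (P (q i′)))
      (trans (cong (_+ P (q i′)) (trans (sym (enter (subst (λ z → y z ≢ b) qz (keep (d + i))))) (cong P (sym qz))))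
      (trans h (trans (cong (λ z → P z + P (q i) + (suc (L + L) + suc (L + L))) (trans (sym eD) (+-comm (q i′) D)))
      (trans (r₂ (P (D + q i′)) (P (q i)) L) (cong (λ z → suc L + (P (D + q i′) + z + (L + L))) (sym (leave (keep i))))))))))
    where
    qz : q (d + i) ≡ suc (D + suc (q i))
    qz = +-cancelʳ-≡ (q i′) _ _ (trans (q-diff i i′ d h) (trans (cong (λ z → 2 + (z + q i)) (sym eD)) (r (q i′) D (q i))))
      where
      r : ∀ a D c → 2 + (a + D + c) ≡ suc (D + suc c) + a
      r = solve-∀
    r₁ : ∀ p L x → suc L + (p + x) ≡ suc (p + L) + x
    r₁ = solve-∀
    r₂ : ∀ a c L → a + c + (suc (L + L) + suc (L + L)) ≡ suc L + (a + suc (c + L) + (L + L))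
    r₂ = solve-∀

  descend : Weighted (L + L) (y ∘ q) f′ (P ∘ q) A′
  descend = record
    { core = core′ ; f≥1 = f′≥1 ; f≤ = λ i j → ≤-trans (at-most-two i) (s≤s (f′≥1 j)) ; stepP = stepP′ ; fbal = fbal′ }

-- The square recurs beyond `q 0`, where every `b` lies in a run.
double-run : ∀ {y P A b q f i} → Core y P A → Gaps y b q f → y i ≡ b → y (suc i) ≡ b → ∃ λ j → 2 ≤ f j
double-run {y} {b = b} {q} {f} {i} c g e₀ e₁ with pair-again c i (q 0)
... | p , q₀≤p , h₀ , h₁ , _ with m≤n⇒∃[o]m+o≡n q₀≤p
... | n , refl with locate g 0 n
... | j , zero  , _ , _  , eq = ⊥-elim (Gaps.keep g j (trans (cong y (trans (sym (+-identityʳ (q j))) (sym eq))) (trans h₀ e₀)))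
... | j , suc t , _ , t< , eq with m≤n⇒m<n∨m≡n t<
... | inj₁ t<f = j , ≤-trans (s≤s (s≤s z≤n)) t<f
... | inj₂ t≡f = ⊥-elim (Gaps.keep g (suc j) (trans
        (cong y (trans (Gaps.step g j) (cong suc (trans (cong (q j +_) (sym t≡f)) (sym eq))))) (trans h₁ e₁)))

-- Reinserting a deleted letter, up to permutation.

swap : ℕ → ℕ → ℕ → ℕ
swap a b n with n ≟ a | n ≟ b
... | yes _ | _     = b
... | no _  | yes _ = a
... | no _  | no _  = n

swap-left : ∀ a b → swap a b a ≡ b
swap-left a b with a ≟ a | a ≟ b
... | yes _ | _ = refl
... | no ne | _ = ⊥-elim (ne refl)

swap-right : ∀ a b → swap a b b ≡ a
swap-right a b with b ≟ a | b ≟ b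
... | yes e | _     = e
... | no _  | yes _ = refl
... | no _  | no ne = ⊥-elim (ne refl)

swap-other : ∀ {a b n} → n ≢ a → n ≢ b → swap a b n ≡ n
swap-other {a} {b} {n} n≢a n≢b with n ≟ a | n ≟ b
... | yes e | _     = ⊥-elim (n≢a e)
... | no _  | yes e = ⊥-elim (n≢b e)
... | no _  | no _  = refl

swap-involutive : ∀ a b n → swap a b (swap a b n) ≡ n
swap-involutive a b n with n ≟ a | n ≟ b
... | yes refl | _        = swap-right a b
... | no _     | yes refl = swap-left a b
... | no n≢a   | no n≢b   = swap-other n≢a n≢b

swap↔ : ℕ → ℕ → ℕ ↔ ℕ
swap↔ a b = mk↔ₛ′ (swap a b) (swap a b) (swap-involutive a b) (swap-involutive a b)

-- Agreement is required from `N` on only, since `Gaps` leaves the letters before `q 0` open.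
-- Periodicity removes this defect in `like-shift`.
Like : Word → Word → Set
Like x v = Σ (ℕ ↔ ℕ) λ π → ∃ λ N → ∃ λ s → ∀ n → x (N + n) ≡ Inverse.to π (v (s + n))

gaps-shift : ∀ {x b q f v c r h} → Gaps x b q f → Gaps v c r h → ∀ N s → (∀ i → f (N + i) ≡ h (s + i)) →
  ∀ i → q (N + i) + r s ≡ r (s + i) + q N
gaps-shift {q = q} {r = r} g g′ N s e zero rewrite +-identityʳ N | +-identityʳ s = +-comm (q N) (r s)
gaps-shift {q = q} {f} {r = r} {h} g g′ N s e (suc i)
  rewrite +-suc N i | +-suc s i | Gaps.step g (N + i) | Gaps.step g′ (s + i) | e i =
  cong suc (trans (ring (q (N + i)) (h (s + i)) (r s)) (trans (cong (_+ h (s + i)) (gaps-shift g g′ N s e i))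
    (sym (ring (r (s + i)) (h (s + i)) (q N)))))
  where
  ring : ∀ a b c → a + b + c ≡ a + c + b
  ring = solve-∀

insert-agree : ∀ {x b q f v c r h} → Gaps x b q f → Gaps v c r h → (G : ℕ → ℕ) → G c ≡ b → ∀ N s →
  (∀ i → f (N + i) ≡ h (s + i)) → (∀ i → x (q (N + i)) ≡ G (v (r (s + i)))) →
  ∀ n → x (q N + n) ≡ G (v (r s + n))
insert-agree {x} {b} {q} {f} {v} {c} {r} {h} g g′ G Gc N s ef ex n with locate g N n
... | j , t , N≤j , t≤ , e with m≤n⇒∃[o]m+o≡n N≤j
... | i , refl = trans (cong x e) (trans (at t t≤) (cong (G ∘ v) (sym e′)))
  where
  e′ : r s + n ≡ r (s + i) + t
  e′ = +-cancelˡ-≡ (q N) _ _ (trans (sym (ring₁ (q N) n (r s))) (trans (cong (_+ r s) e)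
         (trans (ring₂ (q (N + i)) t (r s)) (trans (cong (_+ t) (gaps-shift g g′ N s ef i)) (ring₃ (r (s + i)) (q N) t)))))
    where
    ring₁ : ∀ a b c → a + b + c ≡ a + (c + b)
    ring₁ = solve-∀
    ring₂ : ∀ a b c → a + b + c ≡ a + c + b
    ring₂ = solve-∀
    ring₃ : ∀ a b c → a + b + c ≡ b + (a + c)
    ring₃ = solve-∀
  at : ∀ t → t ≤ f (N + i) → x (q (N + i) + t) ≡ G (v (r (s + i) + t))
  at zero _ = trans (cong x (+-identityʳ _)) (trans (ex i) (cong (G ∘ v) (sym (+-identityʳ _))))
  at (suc t) t< = trans (cong x (+-suc _ t)) (trans (Gaps.fill g (N + i) t t<)
    (sym (trans (cong (G ∘ v) (+-suc _ t)) (trans (cong G (Gaps.fill g′ (s + i) t (subst (t <_) (ef i) t<))) Gc))))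

-- The permutation that fits the kept letters need not send `c` to `b`. Composing it with the
-- transposition of `to c` and `b` repairs this and moves no kept letter, as their images are
-- neither `to c` nor `b`.
like-insert : ∀ {x b q f v c r h V} → Gaps x b q f → Gaps v c r h → (∀ i → v (r i) ≡ V i) →
  (∀ π N s → (∀ n → x (q (N + n)) ≡ Inverse.to π (V (s + n))) → ∀ i → f (N + i) ≡ h (s + i)) →
  Like (x ∘ q) V → Like x v
like-insert {x} {b} {q} {f} {v} {c} {r} {h} {V} g g′ eV match (π , N , s , eq) =
  swap↔ (to c) b ↔-∘ π , q N , r s ,
  insert-agree g g′ (λ z → swap (to c) b (to z)) (swap-left (to c) b) N s (match π N s eq) λ i →
    trans (ex i) (sym (swap-other (λ e → Gaps.keep g′ (s + i) (injective e)) λ e → Gaps.keep g (N + i) (trans (ex i) e)))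
  where
  to = Inverse.to π
  injective : ∀ {m n} → to m ≡ to n → m ≡ n
  injective {m} {n} e = trans (sym (Inverse.strictlyInverseʳ π m)) (trans (cong (Inverse.from π) e) (Inverse.strictlyInverseʳ π n))
  ex : ∀ i → x (q (N + i)) ≡ to (v (r (s + i)))
  ex i = trans (eq i) (cong to (sym (eV (s + i))))

-- Bounded periods.

Period : Word → ℕ → Set
Period x p = 1 ≤ p × ∀ i → x (p + i) ≡ x i

-- By recurrence every factor of length `suc p` reappears beyond `N`, where the period is known.
eventual-period : ∀ {x N p} → Recurrent x → (∀ n → x (p + (N + n)) ≡ x (N + n)) → ∀ i → x (p + i) ≡ x i
eventual-period {x} {N} {p} R h i with R i (suc p) N
... | P , N≤P , e with m≤n⇒∃[o]m+o≡n N≤P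
... | n , refl = trans (cong x (+-comm p i)) (trans (sym (e p ≤-refl)) (trans (cong x (+-comm (N + n) p))
  (trans (h n) (trans (cong x (sym (+-identityʳ _))) (trans (e 0 (s≤s z≤n)) (cong x (+-identityʳ i)))))))

-- The new period is `q p` minus `q 0`: one period of the kept letters together with their runs.
period-insert : ∀ {x b q f p m} → Gaps x b q f → Recurrent x → (∀ i → f i ≤ m) → (∀ i → f (p + i) ≡ f i) →
  Period (x ∘ q) p → ∃ λ p′ → p′ ≤ suc m * p × Period x p′
period-insert {x} {b} {q} {f} {p} {m} g R f≤m fp (p≥1 , yp) with m≤n⇒∃[o]m+o≡n (gaps-mono-≤ g {0} {p} z≤n)
... | p′ , e = p′ , +-cancelˡ-≤ (q 0) _ _ (≤-trans (≤-reflexive e) (bound p)) ,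
    +-cancelˡ-< (q 0) 0 p′ (subst₂ _<_ (sym (+-identityʳ _)) (sym e) (gaps-mono-< g p≥1)) ,
    eventual-period R λ n → trans (cong x (trans (ring p′ (q 0) n) (cong (_+ n) e)))
      (sym (insert-agree g g id refl 0 p (λ i → sym (fp i)) (λ i → sym (yp i)) n))
  where
  ring : ∀ a b c → a + (b + c) ≡ b + a + c
  ring = solve-∀
  bound : ∀ i → q i ≤ q 0 + suc m * i
  bound zero = m≤m+n _ _
  bound (suc i) = subst₂ _≤_ (sym (Gaps.step g i)) (r (q 0) m i) (s≤s (+-mono-≤ (bound i) (f≤m i)))
    where
    r : ∀ a m i → suc (a + suc m * i + m) ≡ a + suc m * suc i
    r = solve-∀

-- The bound on the period is carried along because it limits where a square of a letter has to be
-- sought.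
record Res (x v : Word) (B : ℕ) : Set where
  constructor res
  field
    like   : Like x v
    p      : ℕ
    p≤     : p ≤ B
    period : Period x p

insert-ψ : ∀ {x b q f c V B} n → Gaps x b q f → Recurrent x → (∀ i → f i ≡ n) → (∀ i → V i ≢ c) →
  Res (x ∘ q) V B → Res x (iter (ψ c) n V) (suc n * B)
insert-ψ n g R fn c∉V (res like p p≤ per) with iterψ-gaps c∉V n
  | period-insert g R (λ i → ≤-reflexive (fn i)) (λ i → trans (fn _) (sym (fn i))) per
... | r , g′ , eV | p′ , p′≤ , per′ =
  res (like-insert g g′ eV (λ _ N _ _ i → fn (N + i)) like) p′ (≤-trans p′≤ (*-monoʳ-≤ (suc n) p≤)) per′

ε≤2 : ∀ x y → ε x y ≤ 2
ε≤2 x y with x ≟ y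
... | yes _ = ≤-refl
... | no _  = s≤s z≤n

ε-injective : ∀ (π : ℕ ↔ ℕ) x y → ε (Inverse.to π x) (Inverse.to π y) ≡ ε x y
ε-injective π x y with x ≟ y
... | yes refl = ε-≡ {Inverse.to π x} refl
... | no ne = ε-≢ λ e → ne (trans (sym (Inverse.strictlyInverseʳ π x)) (trans (cong (Inverse.from π) e) (Inverse.strictlyInverseʳ π y)))

insert-σ : ∀ {x b q f c V B} → Gaps x b q f → Recurrent x → (∀ i → f i ≡ ε (x (q i)) (x (q (suc i)))) → (∀ i → V i ≢ c) →
  Res (x ∘ q) V B → Res x (σ c V) (3 * B)
insert-σ {x} {b} {q} {f} {c} {V} g R fε c∉V (res like p p≤ per)
  with period-insert g R (λ i → subst (_≤ 2) (sym (fε i)) (ε≤2 _ _))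
         (λ i → trans (fε _) (trans (cong₂ ε (proj₂ per i) (trans (cong (x ∘ q) (sym (+-suc p i))) (proj₂ per (suc i)))) (sym (fε i)))) per
... | p′ , p′≤ , per′ = res (like-insert g (σ-gaps c∉V) (σ-at c V) match like) p′ (≤-trans p′≤ (*-monoʳ-≤ 3 p≤)) per′
  where
  match : ∀ π N s → (∀ n → x (q (N + n)) ≡ Inverse.to π (V (s + n))) →
    ∀ i → f (N + i) ≡ ε (V (s + i)) (V (suc (s + i)))
  match π N s e i = trans (fε (N + i)) (trans (cong₂ ε (e i)
    (trans (cong (x ∘ q) (sym (+-suc N i))) (trans (e (suc i)) (cong (Inverse.to π ∘ V) (+-suc s i))))) (ε-injective π _ _))

core-recurrent : ∀ {y P A} → Core y P A → Recurrent y
core-recurrent c i n m with Core.rec c i n m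
... | p , m≤p , h = p , m≤p , λ t t< → proj₁ (h t (<⇒≤ t<))

other-letter : ∀ {A : List ℕ} {r} → Unique A → length A ≡ suc (suc r) → ∀ b → ∃ λ e → e ∈ A × e ≢ b
other-letter {x ∷ x′ ∷ _} ((x≢ ∷ _) ∷ _) _ b with x ≟ b
... | yes refl = x′ , there (here refl) , λ e → x≢ (sym e)
... | no ne    = x , here refl , ne

one-letter : ∀ {y P A} → Core y P A → length A ≡ 1 → ∀ i → y i ≡ y 0
one-letter {A = a ∷ []} c _ i with Core.mem c i | Core.mem c 0
... | here e | here e′ = trans e (sym e′)

ψRange-≥ : ∀ {b} j n {x} → b ≤ j → (∀ i → b ≤ x i) → ∀ i → b ≤ ψRange j n x i
ψRange-≥ j zero    b≤j h = h
ψRange-≥ {b} j (suc n) b≤j h = ψ-All {b ≤_} b≤j (ψRange-≥ (suc j) n (m≤n⇒m≤1+n b≤j) h)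

σRange-≥ : ∀ {b} j n {x} → b ≤ j → (∀ i → b ≤ x i) → ∀ i → b ≤ σRange j n x i
σRange-≥ j zero    b≤j h = h
σRange-≥ {b} j (suc n) b≤j h = σ-All {b ≤_} b≤j (σRange-≥ (suc j) n (m≤n⇒m≤1+n b≤j) h)

-- Equally spaced letters and ruler words.

linear : ∀ {P : ℕ → ℕ} {e} → (∀ i → P (suc i) ≡ e + P i) → ∀ d i → P (d + i) ≡ d * e + P i
linear h zero    i = refl
linear {P} {e} h (suc d) i = trans (h (d + i)) (trans (cong (e +_) (linear h d i)) (sym (+-assoc e (d * e) (P i))))

module _ {y : Word} {P : ℕ → ℕ} {A : List ℕ} {e : ℕ} (c : Core y P A) (lin : ∀ i → P (suc i) ≡ 2 + e + P i) where

  -- All steps have the same original length, which is at least 2, so one additional step already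
  -- violates balance.
  linear-return : ∀ {i j i′ d} → CR y i j → CR y i′ (d + i′) → y i ≡ y i′ → j ≤ d + i
  linear-return {i} {j} {i′} {d} cr cr′ eq = ≮⇒≥ λ h → absurd h
    where
    absurd : d + i < j → ⊥
    absurd h with m≤n⇒∃[o]m+o≡n h
    ... | o , eo = absurd-≤ (e + o * (2 + e))
      (subst₂ (λ a b → a + P i′ ≤ suc (b + P i)) (trans (cong P (trans (sym eo) (r₀ d i o))) (linear {P} {2 + e} lin (suc d + o) i)) (linear {P} {2 + e} lin d i′)
        (Core.bal c cr cr′ eq))
      (r d o e (P i) (P i′))
      where
      r₀ : ∀ d i o → suc (d + i) + o ≡ suc d + o + i
      r₀ = solve-∀
      r : ∀ d o e p p′ → (suc d + o) * (2 + e) + p + p′ ≡ suc (suc (d * (2 + e) + p′ + p) + (e + o * (2 + e)))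
      r = solve-∀

  linear-squarefree : ∀ {a} → a ∈ A → ∀ i → a ≢ y i → y i ≢ y (suc i)
  linear-squarefree a∈ i ne sq with occ-≥ c a∈ i
  ... | t , i≤t , refl with enclose c refl i≤t ne
  ... | u , v , cr , eu , _ , u<t , t<v = <⇒≱ (≤-trans (s≤s u<t) t<v) (linear-return {d = 1} cr (square-return sq) eu)

Res-≤ : ∀ {x v B B′} → B ≤ B′ → Res x v B → Res x v B′
Res-≤ h (res like p p≤ per) = res like p (≤-trans p≤ h) per

record Alternating (y : Word) (P : ℕ → ℕ) (r : ℕ) : Set where
  field
    {b}    : ℕ
    {q f}  : ℕ → ℕ
    {A}    : List ℕ
    e      : ℕ
    gaps   : Gaps y b q f
    ones   : ∀ i → f i ≡ 1
    len    : length A ≡ suc r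
    core   : Core (y ∘ q) (P ∘ q) A
    lin    : ∀ i → P (q (suc i)) ≡ 2 + e + P (q i)

-- With two letters or more there is no square, so the centre of a return yields a letter occupying
-- every second position. Deleting it doubles the spacing, and twice `2 + e` is `2 + (e + (2 + e))`.
alternating : ∀ {y P A r} e → Core y P A → (∀ i → P (suc i) ≡ 2 + e + P i) → length A ≡ suc (suc r) → Alternating y P r
alternating {y} {P} {A} {r} e core lin len = build two-gap
  where
  squarefree : ∀ i → y i ≢ y (suc i)
  squarefree i sq with other-letter (Core.uniq core) len (y i)
  ... | a , a∈ , ne = linear-squarefree core lin a∈ i ne sq
  two-gap : ∃ λ m → CR y m (2 + m)
  two-gap with center core (proj₂ (return core 0))
  ... | inj₁ (m , sq) = ⊥-elim (squarefree m sq)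
  ... | inj₂ two      = two
  finish : ∀ {b} → Deletion y P b (length A) → Alternating y P r
  finish D = record
    { e = e + (2 + e) ; gaps = gaps ; ones = f≡1 ; len = suc-injective (trans (sym len′) len) ; core = core′ ; lin = lin′ }
    where
    open Deletion D renaming (core to core′; len to len′; A to A′)
    f≡1 : ∀ i → f i ≡ 1
    f≡1 i = ≤-antisym (≮⇒≥ λ 2≤ → squarefree (suc (q i + 0)) (trans (Gaps.fill gaps i 0 (<⇒≤ 2≤))
        (sym (trans (cong (y ∘ suc) (sym (+-suc (q i) 0))) (Gaps.fill gaps i 1 2≤))))) (f≥1 i)
    lin′ : ∀ i → P (q (suc i)) ≡ 2 + (e + (2 + e)) + P (q i)
    lin′ i = trans (cong P (trans (Gaps.step gaps i) (cong suc (trans (cong (q i +_) (f≡1 i)) (+-comm (q i) 1)))))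
      (trans (lin (suc (q i))) (trans (cong (2 + e +_) (lin (q i))) (sym (+-assoc (2 + e) (2 + e) (P (q i))))))
  build : (∃ λ m → CR y m (2 + m)) → Alternating y P r
  build (m , cr) with other-letter (Core.uniq core) len (y m)
  ... | a , a∈ , ne = finish (delete core (Core.mem core m) a∈ ne
                        (separating core (λ cr′ e′ → linear-return core lin {d = 2} cr′ cr e′)))

-- Each round names the letter at every second position `c` and removes it, until the word is
-- constant. The bound `c + r ≤ k` keeps `c` apart from the names used later.
ruler : ∀ r c {k y P A} e → c + r ≤ k → Core y P A → (∀ i → P (suc i) ≡ 2 + e + P i) → length A ≡ suc r →
  Res y (ψRange c r (constW k)) (3 ^ r)
ruler zero c {k} {y} e _ core lin len =
  res (swap↔ k (y 0) , 0 , 0 , λ n → trans (const n) (sym (swap-left k (y 0)))) 1 ≤-refl (≤-refl , λ i → trans (const (suc i)) (sym (const i)))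
  where
  const = one-letter core len
ruler (suc r) c {k} e c≤k core lin len =
  -- A round only doubles the period; the factor 3 matches the growth under σ.
  Res-≤ (*-monoˡ-≤ (3 ^ r) {2} {3} (n≤1+n 2))
    (insert-ψ 1 S.gaps (core-recurrent core) S.ones
      (λ i e → <⇒≢ (ψRange-≥ (suc c) r ≤-refl (λ _ → ≤-trans (m≤m+n (suc c) r) c<k) i) (sym e))
      (ruler r (suc c) S.e c<k S.core S.lin S.len))
  where
  module S = Alternating (alternating e core lin len)
  c<k : suc c + r ≤ k
  c<k = subst (_≤ k) (+-suc c r) c≤k

-- Under a constant weight `n` the kept letters are equally spaced, at distance `1 + n * suc l` in
-- the original word, so they form a ruler word.
ends : ∀ {r c k n l x b q f P A} → suc c + r ≤ k → length A ≡ suc r → Gaps x b q f → Recurrent x →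
  Weighted l (x ∘ q) f P A → (∀ i → f i ≡ n) → Res x (iter (ψ c) n (ψRange (suc c) r (constW k))) (suc n * 3 ^ r)
ends {r} {c} {k} {n} {l} {P = P} c<k len g R W fn =
  insert-ψ n g R fn
    (λ i e → <⇒≢ (ψRange-≥ (suc c) r ≤-refl (λ _ → ≤-trans (m≤m+n (suc c) r) c<k) i) (sym e))
    (ruler r (suc c) (proj₁ slope) c<k (Weighted.core W) (proj₂ slope) len)
  where
  slope : ∃ λ e → ∀ i → P (suc i) ≡ 2 + e + P i
  slope with m≤n⇒∃[o]m+o≡n (subst (1 ≤_) (fn 0) (Weighted.f≥1 W 0))
  ... | m , e = l + m * suc l , λ i → trans (Weighted.stepP W i)
    (trans (cong (λ z → suc (P i + z * suc l)) (trans (fn i) (sym e))) (ring (P i) l m))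
    where
    ring : ∀ p l m → suc (p + suc m * suc l) ≡ 2 + (l + m * suc l) + p
    ring = solve-∀

-- Chains of σ.

one-letter-weight : ∀ {l y f P A} → Weighted (suc l) y f P A → length A ≡ 1 → ∀ i j → f i ≤ f j
one-letter-weight {l} {y} {f} {P} W len i j = ≮⇒≥ λ h →
  -- Every step is a complete return to the only letter. The block has length `2 + l`, so unequal
  -- weights make these returns differ by at least 2.
  absurd-≤ l (+-mono-≤ (subst₂ (λ a b → a + P j ≤ suc (b + P i)) (stepP i) (stepP j)
                (Core.bal core (sq i) (sq j) (trans (const i) (sym (const j))))) (*-monoˡ-≤ (2 + l) h))
    (ring (P i) (P j) (f i * (2 + l)) (f j) l)
  where
  open Weighted W
  const = one-letter core len
  sq : ∀ i → CR y i (suc i)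
  sq i = square-return (trans (const i) (sym (const (suc i))))
  ring : ∀ p q a b l → suc (p + a) + q + suc b * (2 + l) ≡ suc (suc (suc (q + b * (2 + l)) + p) + a + l)
  ring = solve-∀

-- Here `ψRange d` itself starts with `ψ d`, which produces the square of that morphism. For `j = 0`
-- no σ is applied.
record Chain (x : Word) (r c k : ℕ) : Set where
  constructor chained
  field
    j d    : ℕ
    j≤     : j ≤ r
    c+j    : c + j ≡ d
    result : Res x (σRange c j (ψ d (ψRange d (k ∸ d) (constW k)))) (3 ^ suc r)

-- If the weight 2 at `i₀` lies between different letters, there are no squares and all weights are
-- 2. Otherwise `chain-step` removes the letter of the square. The index `suc l`, available after
-- any descent, serves `one-letter-weight` when a single letter remains.
chain : ∀ r c k {l x b q f P A} i₀ → suc c + r ≡ k → length A ≡ suc r → Gaps x b q f → Recurrent x →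
  Weighted (suc l) (x ∘ q) f P A → (∀ i → f i ≤ 2) → 2 ≤ f i₀ → Chain x r c k

chain-end : ∀ {r c k l x b q f P A} → suc c + r ≡ k → length A ≡ suc r → Gaps x b q f → Recurrent x →
  Weighted l (x ∘ q) f P A → (∀ i → f i ≡ 2) → Chain x r c k
chain-end {r} {c} {k} {x = x} ck len g R W f≡2 = chained 0 c z≤n (+-identityʳ c)
  (subst (λ m → Res x (ψ c (ψRange c m (constW k))) (3 ^ suc r))
    (sym (trans (cong (_∸ c) (trans (sym ck) (sym (+-suc c r)))) (m+n∸m≡n c (suc r))))
    (ends (≤-reflexive ck) len g R W f≡2))

-- Were there a square anywhere, `edges` would confine weight 2 to squares, contrary to the pair at
-- `i₀`.
squarefree-unless : ∀ {l y f P A r i₀} → (W : Weighted l y f P A) → length A ≡ suc (suc r) → 2 ≤ f i₀ →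
  y i₀ ≢ y (suc i₀) → ∀ i → y i ≢ y (suc i)
squarefree-unless {y = y} {i₀ = i₀} W len 2≤ ne i sq with other-letter (Core.uniq (Weighted.core W)) len (y i)
... | e , e∈ , e≢ with edges W sq e∈ e≢ i₀
... | single f≡1 _ _ = <⇒≱ 2≤ (≤-reflexive f≡1)
... | double _ e₀ e₁ = ne (trans e₀ (sym e₁))

edge-ε : ∀ {l y f P A b t} {W : Weighted l y f P A} → Edge W b t → f t ≡ ε (y t) (y (suc t))
edge-ε (single e ne _)   = trans e (sym (ε-≢ ne))
edge-ε {y = y} {t = t} (double e e₀ e₁) = trans e (sym (ε-≡ {y t} (trans e₀ (sym e₁))))

edge-separates : ∀ {l y f P A b t} {W : Weighted l y f P A} → Edge W b t → y t ≡ b ⊎ y (suc t) ≡ b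
edge-separates (single _ _ s) = s
edge-separates (double _ e _) = inj₁ e

-- By `edges` the weights are the exponents of σ, so `x` is a σ-image of its kept word. The letter
-- of the square separates that word, and its deletion leads back to `chain` with one letter fewer.
-- The block length is arbitrary, so the first deletion, with blocks of one letter, is covered.
chain-step : ∀ r c k {l x b q f P A} i₀ → suc c + suc r ≡ k → length A ≡ suc (suc r) → Gaps x b q f → Recurrent x →
  Weighted l (x ∘ q) f P A → x (q i₀) ≡ x (q (suc i₀)) →
  ∃ λ j → ∃ λ d → j ≤ r × suc c + j ≡ d × Res x (σRange c (suc j) (ψ d (ψRange d (k ∸ d) (constW k)))) (3 ^ suc (suc r))
chain-step r c k {l} {x} {q = q} {f} {P} {A} i₀ ck len g R W sq = finish (other-letter (Core.uniq core) len (x (q i₀)))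
  where
  open Weighted W
  finish : (∃ λ e → e ∈ A × e ≢ x (q i₀)) → _
  finish (e , e∈ , e≢) = build (delete core (Core.mem core i₀) e∈ e≢ (λ t → edge-separates (edge t)))
    where
    edge = edges W sq e∈ e≢
    build : Deletion (x ∘ q) P (x (q i₀)) (length A) → _
    build D = lift (chain r (suc c) k (proj₁ twice) (trans (cong suc (sym (+-suc c r))) ck)
                (suc-injective (trans (sym len′) len)) gaps (core-recurrent core)
                (descend W edge gaps D.f≥1 core′) (at-most-two W edge gaps D.f≥1 core′) (proj₂ twice))
      where
      module D = Deletion D
      open Deletion D using (gaps) renaming (core to core′; len to len′)
      twice : ∃ λ j → 2 ≤ D.f j
      twice = double-run core gaps refl (sym sq)
      lift : Chain (x ∘ q) r (suc c) k → _
      lift (chained j d j≤ e result) = j , d , j≤ , e ,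
        insert-σ g R (λ i → edge-ε (edge i)) (λ i e′ → <⇒≢ (σRange-≥ (suc c) j ≤-refl above i) (sym e′)) result
        where
        c<d : suc c ≤ d
        c<d = subst (suc c ≤_) e (m≤m+n (suc c) j)
        above : ∀ i → suc c ≤ ψ d (ψRange d (k ∸ d) (constW k)) i
        above = ψ-All {suc c ≤_} c<d (ψRange-≥ d (k ∸ d) c<d (λ _ → subst (suc c ≤_) ck (m≤m+n (suc c) (suc r))))

chain zero c k i₀ ck len g R W f≤2 2≤ = chain-end ck len g R W λ i →
  ≤-antisym (f≤2 i) (≤-trans 2≤ (one-letter-weight W len i₀ i))
chain (suc r) c k {x = x} {q = q} {f} i₀ ck len g R W f≤2 2≤ = decide (x (q i₀) ≟ x (q (suc i₀)))
  where
  decide : Dec (x (q i₀) ≡ x (q (suc i₀))) → Chain x (suc r) c k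
  decide (no ne) = constant (weight-constant W (squarefree-unless W len 2≤ ne))
    where
    constant : (∃ λ n → ∀ i → f i ≡ n) → Chain x (suc r) c k
    constant (n , fn) = chain-end ck len g R W λ i → trans (fn i) (trans (sym (fn i₀)) (≤-antisym (f≤2 i₀) 2≤))
  decide (yes sq) = wrap (chain-step r c k i₀ ck len g R W sq)
    where
    wrap : (∃ λ j → ∃ λ d → j ≤ r × suc c + j ≡ d × Res x (σRange c (suc j) (ψ d (ψRange d (k ∸ d) (constW k)))) (3 ^ suc (suc r))) → Chain x (suc r) c k
    wrap (j , d , j≤ , e , result) = chained (suc j) d (s≤s j≤) (trans (+-suc c j) e) result

-- Counting letters

count-hit : ∀ w a i n → w (i + n) ≡ a → count w a i (suc n) ≡ suc (count w a i n)
count-hit w a i n e with w (i + n) ≟ a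
... | yes _ = refl
... | no ne = ⊥-elim (ne e)

count-miss : ∀ w a i n → w (i + n) ≢ a → count w a i (suc n) ≡ count w a i n
count-miss w a i n ne with w (i + n) ≟ a
... | yes e = ⊥-elim (ne e)
... | no _  = refl

count-all : ∀ w a i n → (∀ t → t < n → w (i + t) ≡ a) → count w a i n ≡ n
count-all w a i zero    h = refl
count-all w a i (suc n) h =
  trans (count-hit w a i n (h n ≤-refl)) (cong suc (count-all w a i n (λ t t< → h t (m≤n⇒m≤1+n t<))))

count-none : ∀ w a i n → (∀ t → t < n → w (i + t) ≢ a) → count w a i n ≡ 0
count-none w a i zero    h = refl
count-none w a i (suc n) h =
  trans (count-miss w a i n (h n ≤-refl)) (count-none w a i n (λ t t< → h t (m≤n⇒m≤1+n t<)))

count-+ : ∀ w a i m n → count w a i (m + n) ≡ count w a i m + count w a (i + m) n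
count-+ w a i m zero = trans (cong (count w a i) (+-identityʳ m)) (sym (+-identityʳ _))
count-+ w a i m (suc n) = trans (cong (count w a i) (+-suc m n)) (last (w (i + (m + n)) ≟ a))
  where
  e : i + (m + n) ≡ i + m + n
  e = sym (+-assoc i m n)
  last : Dec (w (i + (m + n)) ≡ a) → count w a i (suc (m + n)) ≡ count w a i m + count w a (i + m) (suc n)
  last (yes h) = trans (count-hit w a i (m + n) h) (trans (cong suc (count-+ w a i m n))
    (trans (sym (+-suc _ _)) (cong (count w a i m +_) (sym (count-hit w a (i + m) n (trans (cong w (sym e)) h))))))
  last (no h) = trans (count-miss w a i (m + n) h) (trans (count-+ w a i m n)
    (cong (count w a i m +_) (sym (count-miss w a (i + m) n (λ h′ → h (trans (cong w e) h′))))))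

count-hit-first : ∀ w a i n → w i ≡ a → count w a i (suc n) ≡ suc (count w a (suc i) n)
count-hit-first w a i n e = trans (count-+ w a i 1 n)
  (cong₂ _+_ (count-hit w a i 0 (trans (cong w (+-identityʳ i)) e)) (cong (λ z → count w a z n) (+-comm i 1)))

count-miss-first : ∀ w a i n → w i ≢ a → count w a i (suc n) ≡ count w a (suc i) n
count-miss-first w a i n ne = trans (count-+ w a i 1 n)
  (cong₂ _+_ (count-miss w a i 0 (λ e → ne (trans (cong w (sym (+-identityʳ i))) e))) (cong (λ z → count w a z n) (+-comm i 1)))

-- The stretch consists of `d` kept letters and copies of `a`.
count-gaps : ∀ {w a q f} → Gaps w a q f → ∀ i d → ∃ λ D → q (d + i) ≡ q i + D × count w a (q i) D + d ≡ D
count-gaps {q = q} g i zero = 0 , sym (+-identityʳ (q i)) , refl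
count-gaps {w} {a} {q} {f} g i (suc d) with count-gaps g i d
... | D , e , h = D + suc n , trans (Gaps.step g (d + i)) (trans (cong (λ z → suc (z + n)) e) (ring₁ (q i) D n)) ,
  trans (cong (_+ suc d) (trans (count-+ w a (q i) D (suc n)) (cong (count w a (q i) D +_) block)))
    (trans (ring₂ (count w a (q i) D) n d) (cong (_+ suc n) h))
  where
  n = f (d + i)
  block : count w a (q i + D) (suc n) ≡ n
  block = trans (cong (λ z → count w a z (suc n)) (sym e))
    (trans (count-miss-first w a (q (d + i)) n (Gaps.keep g (d + i))) (count-all w a _ n (Gaps.fill g (d + i))))
  ring₁ : ∀ a D n → suc (a + D + n) ≡ a + (D + suc n)
  ring₁ = solve-∀
  ring₂ : ∀ c n d → c + n + suc d ≡ c + d + suc n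
  ring₂ = solve-∀

-- If the first return were longer by 2 or more, its interior would contain a factor without the
-- letter that is as long as the whole second return, which has two occurrences.
return-balanced : ∀ {w i j i′ j′} → Balanced w → CR w i j → CR w i′ j′ → w i ≡ w i′ → j + i′ ≤ suc (j′ + i)
return-balanced {w} {i} {j} {i′} {j′} B cr cr′ e with m≤n⇒∃[o]m+o≡n (CR.lt cr′)
... | d′ , refl = ≮⇒≥ λ h → <⇒≱ (≤-trans two (B i′ (suc i) (2 + d′) (w i))) (s≤s (≤-reflexive (none h)))
  where
  two : 2 ≤ count w (w i) i′ (2 + d′)
  two = ≤-trans (s≤s (subst (1 ≤_) (sym (count-hit-first w (w i) i′ d′ (sym e))) (s≤s z≤n)))
    (≤-reflexive (sym (count-hit w (w i) i′ (suc d′) (trans (cong w (+-suc i′ d′)) (trans (CR.same cr′) (sym e))))))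
  none : suc (suc i′ + d′ + i) < j + i′ → count w (w i) (suc i) (2 + d′) ≡ 0
  none h = count-none w (w i) (suc i) (2 + d′) λ t t< → CR.none cr (suc i + t) (s≤s (m≤m+n i t))
    (≤-trans (+-monoʳ-< (suc i) t<) (cancel-≤ i′ h (ring i′ d′ i) refl))
    where
    ring : ∀ a d i → suc (suc (suc a + d + i)) ≡ suc i + (2 + d) + a
    ring = solve-∀

-- The given word as the starting point of the descent.

base-core : ∀ {k w} → AlphabetExactly k w → Recurrent w → Balanced w → WeaklyRich w → Core w id (map suc (upTo k))
base-core {k} {w} (range , onto) R B rich = record
  { uniq = Unique.map⁺ suc-injective (Unique.upTo⁺ k)
  ; mem  = mem
  ; occ  = occ
  ; rec  = rec
  ; pal  = pal
  ; bal  = return-balanced B }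
  where
  mem : ∀ i → w i ∈ map suc (upTo k)
  mem i with w i | range i
  ... | suc a | _ , a<k = ∈-map⁺ suc (∈-upTo⁺ a<k)
  occ : ∀ {a} → a ∈ map suc (upTo k) → ∃ λ i → w i ≡ a
  occ a∈ with ∈-map⁻ suc a∈
  ... | n , n∈ , refl = onto (suc n) (s≤s z≤n) (∈-upTo⁻ n∈)
  rec : ∀ i n m → ∃ λ p → m ≤ p × (∀ t → t ≤ n → w (p + t) ≡ w (i + t) × p + t + i ≡ i + t + p)
  rec i n m with R i (suc n) m
  ... | p , m≤p , h = p , m≤p , λ t t≤ → h t (s≤s t≤) , ring p t i
    where
    ring : ∀ p t i → p + t + i ≡ i + t + p
    ring = solve-∀
  pal : ∀ {i j} → CR w i j → ∀ u v → u + v ≡ i + j → i ≤ u → i ≤ v → w u ≡ w v × u + v ≡ i + j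
  pal {i} {j} cr u v e i≤u i≤v with m≤n⇒∃[o]m+o≡n i≤u
  ... | t , refl = trans (rich (w i) i j (lt , refl , same , none) t t≤) (cong w (trans (cong (_∸ t) (sym tv)) (m+n∸m≡n t v))) , e
    where
    open CR cr
    tv : t + v ≡ j
    tv = +-cancelˡ-≡ i _ _ (trans (sym (+-assoc i t v)) e)
    t≤ : t ≤ j ∸ i
    t≤ = m+n≤o⇒m≤o∸n t (≤-trans (+-monoʳ-≤ t i≤v) (≤-reflexive tv))

-- Both `f≤` and `fbal` compare a factor strictly between two kept positions with an equally long
-- factor that begins and ends with a kept letter. A violation would make the counts of `a` differ
-- by 2.
base-weighted : ∀ {w a q f A} → Balanced w → Gaps w a q f → (∀ i → 1 ≤ f i) → Core (w ∘ q) q A → Weighted 0 (w ∘ q) f q A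
base-weighted {w} {a} {q} {f} B g f≥1 c = record
  { core  = c
  ; f≥1   = f≥1
  ; f≤    = f≤
  ; stepP = λ i → trans (step i) (cong (λ z → suc (q i + z)) (sym (*-identityʳ (f i))))
  ; fbal  = fbal }
  where
  open Gaps g
  f≤ : ∀ i j → f i ≤ suc (f j)
  f≤ i j = ≮⇒≥ λ h → 1+n≰n (subst₂ (λ c d → c ≤ suc d)
    (count-all w a (suc (q i)) (2 + f j) (λ t t< → fill i t (≤-trans t< h)))
    (trans (count-miss w a (q j) (suc (f j)) (λ e → keep (suc j) (trans (cong w (trans (step j) (sym (+-suc (q j) (f j))))) e)))
      (trans (count-miss-first w a (q j) (f j) (keep j)) (count-all w a (suc (q j)) (f j) (fill j))))
    (B (suc (q i)) (q j) (2 + f j) a))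
  fbal : ∀ i i′ d → q (d + i) + q i′ ≢ q (d + i′) + q i + 2
  fbal i i′ d h with count-gaps g i d | count-gaps g i′ d
  ... | D , e , n | D′ , e′ , n′ = absurd-≤ 0 (+-monoˡ-≤ d (subst₂ (λ c d → c ≤ suc d) first second (B (suc (q i)) (q i′) (suc D′) a)))
      (trans (trans n D≡) (trans (cong (2 +_) (sym n′)) (ring (count w a (q i′) D′ + d))))
    where
    ring : ∀ c → 2 + c ≡ suc (suc c + 0)
    ring = solve-∀
    D≡ : D ≡ 2 + D′
    D≡ = +-cancelˡ-≡ (q i + q i′) _ _ (trans (r₁ (q i) (q i′) D) (trans (cong (_+ q i′) (sym e))
           (trans h (trans (cong (λ z → z + q i + 2) e′) (r₂ (q i) (q i′) D′)))))
      where
      r₁ : ∀ a b D → a + b + D ≡ a + D + b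
      r₁ = solve-∀
      r₂ : ∀ a b D → b + D + a + 2 ≡ a + b + (2 + D)
      r₂ = solve-∀
    first : count w a (suc (q i)) (suc D′) ≡ count w a (q i) D
    first = trans (sym (count-miss-first w a (q i) (suc D′) (keep i))) (cong (count w a (q i)) (sym D≡))
    second : count w a (q i′) (suc D′) ≡ count w a (q i′) D′
    second = count-miss w a (q i′) D′ (λ e″ → keep (d + i′) (trans (cong w e′) e″))

-- Genuine shifts, and squares near the beginning.

period-multiple : ∀ {x p} → Period x p → ∀ m n → x (m * p + n) ≡ x n
period-multiple per zero n = refl
period-multiple {x} {p} per (suc m) n = trans (cong x (+-assoc p (m * p) n)) (trans (proj₂ per (m * p + n)) (period-multiple per m n))

-- Moving by `N * p` leaves `w` unchanged and leads past `N`, where the agreement holds; the shift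
-- grows by `N * p` minus `N`.
like-shift : ∀ w v {p} → Like w v → Period w p → Σ (ℕ ↔ ℕ) λ π → ∃ λ s → ShiftUpTo π s v w
like-shift w v {p} (π , N , s , e) per with m≤n⇒∃[o]m+o≡n (subst (_≤ N * p) (*-identityʳ N) (*-monoʳ-≤ N (proj₁ per)))
... | o , eo = π , s + o , λ n → trans (sym (period-multiple per N n))
  (trans (cong w (trans (cong (_+ n) (sym eo)) (+-assoc N o n)))
  (trans (e (o + n)) (cong (Inverse.to π ∘ v) (sym (+-assoc s o n)))))

square-early : ∀ {w p i} → Period w p → w i ≡ w (suc i) → ∃ λ i′ → i′ < p × w i′ ≡ w (suc i′)
square-early {w} {suc p} {i} per sq = r , m%n<n i (suc p) ,
  trans (sym (back r)) (trans (cong w i≡) (trans sq (trans (cong (w ∘ suc) (sym i≡)) (trans (cong w (sym (+-suc (m * suc p) r))) (back (suc r))))))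
  where
  r = i % suc p
  m = i / suc p
  back = period-multiple per m
  i≡ : m * suc p + r ≡ i
  i≡ = trans (+-comm (m * suc p) r) (sym (m≡m%n+[m/n]*n i (suc p)))

-- The first four letters recur beyond `q 0`, and any four letters there contain `aa`: the worst
-- start is the last letter of a run, followed by a kept letter and the next run. The bound is
-- independent of the run lengths.
run-early : ∀ {w a q f} → Gaps w a q f → (∀ i → 2 ≤ f i) → Recurrent w → ∃ λ i → i < 3 × w i ≡ w (suc i)
run-early {w} {a} {q} {f} g f≥2 R with R 0 4 (q 0)
... | p , q₀≤p , h with m≤n⇒∃[o]m+o≡n q₀≤p
... | n , refl with locate g 0 n
... | i , t , _ , t≤ , e = found t t≤ e
  where
  open Gaps g
  move : ∀ m → m < 3 → w (q 0 + n + m) ≡ a → w (q 0 + n + suc m) ≡ a → ∃ λ i → i < 3 × w i ≡ w (suc i)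
  move m m<3 e₀ e₁ = m , m<3 , trans (sym (h m (m≤n⇒m≤1+n m<3))) (trans (trans e₀ (sym e₁)) (h (suc m) (s≤s m<3)))
  first-two : ∀ j s → s < 2 → w (q j + suc s) ≡ a
  first-two j s s< = trans (cong w (+-suc (q j) s)) (fill j s (≤-trans s< (f≥2 j)))
  found : ∀ t → t ≤ f i → q 0 + n ≡ q i + t → ∃ λ i → i < 3 × w i ≡ w (suc i)
  found zero _ e = move 1 (s≤s (s≤s z≤n)) (trans (cong (λ z → w (z + 1)) e′) (first-two i 0 (s≤s z≤n)))
                                          (trans (cong (λ z → w (z + 2)) e′) (first-two i 1 ≤-refl))
    where
    e′ = trans e (+-identityʳ (q i))
  found (suc t) t< e with m≤n⇒m<n∨m≡n t<
  ... | inj₁ t<f = move 0 (s≤s z≤n)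
        (trans (cong w (trans (+-identityʳ _) (trans e (+-suc (q i) t)))) (fill i t t<))
        (trans (cong w (trans (cong (_+ 1) e) (ring (q i) t))) (fill i (suc t) t<f))
    where
    ring : ∀ a t → a + suc t + 1 ≡ suc (a + suc t)
    ring = solve-∀
  ... | inj₂ t≡f = move 2 ≤-refl (trans (cong w (shift 1)) (first-two (suc i) 0 (s≤s z≤n))) (trans (cong w (shift 2)) (first-two (suc i) 1 ≤-refl))
    where
    shift : ∀ s → q 0 + n + suc s ≡ q (suc i) + s
    shift s = trans (+-suc _ s) (cong (_+ s) (sym (trans (step i) (cong suc (trans (cong (q i +_) (sym t≡f)) (sym e))))))

-- The case distinction.

Conclusion : ℕ → Word → Set
Conclusion k w =
  (Σ (ℕ ↔ ℕ) λ π → ∃ λ s → ∃ λ n → 1 ≤ n × ShiftUpTo π s (word1 k n) w)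
  ⊎ (Σ (ℕ ↔ ℕ) λ π → ∃ λ s → ∃ λ j → 1 ≤ j × j ≤ k ∸ 2 × ShiftUpTo π s (word2 k j) w)

module _ {k : ℕ} {w : Word} (alph : AlphabetExactly (3 + k) w) (R : Recurrent w) (B : Balanced w) (rich : WeaklyRich w) where

  private
    core : Core w id (map suc (upTo (3 + k)))
    core = base-core alph R B rich

    size : length (map suc (upTo (3 + k))) ≡ 3 + k
    size = trans (length-map suc (upTo (3 + k))) (length-upTo (3 + k))

    Del : ℕ → Set
    Del a = Deletion w id a (length (map suc (upTo (3 + k))))

  delete-short : ∀ i₀ → (∀ {i j} → CR w i j → w i ≡ w i₀ → j ≤ 2 + i) → Del (w i₀)
  delete-short i₀ short with other-letter (Core.uniq core) size (w i₀)
  ... | e , e∈ , e≢ = delete core (Core.mem core i₀) e∈ e≢ (separating core short)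

  constant-case : ∀ {a n} (D : Del a) → 1 ≤ n → (∀ i → Deletion.f D i ≡ n) → Conclusion (3 + k) w
  constant-case {n = n} D n≥1 fn = inj₁ (pack (like-shift w (word1 (3 + k) n) result.like result.period))
    where
    open Deletion D
    module result = Res (ends {suc k} {1} {3 + k} ≤-refl (suc-injective (trans (sym len) size)) gaps R
                          (base-weighted B gaps f≥1 (Deletion.core D)) fn)
    pack : (Σ (ℕ ↔ ℕ) λ π → ∃ λ s → ShiftUpTo π s (word1 (3 + k) n) w) →
           Σ (ℕ ↔ ℕ) λ π → ∃ λ s → ∃ λ n → 1 ≤ n × ShiftUpTo π s (word1 (3 + k) n) w
    pack (π , s , h) = π , s , n , n≥1 , h

  -- The 3 comes from `run-early` and serves case 1; the power of 3 bounds the period in case 2.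
  square-bound : ℕ
  square-bound = 3 + 3 ^ (2 + k)

  -- The early square accompanies the conclusion so that a bounded search can decide whether there
  -- is any square at all.
  SquareResult : Set
  SquareResult = Conclusion (3 + k) w × ∃ λ i → i < square-bound × w i ≡ w (suc i)

  -- Balance against the square limits all returns to its letter to two steps, so this letter can be
  -- deleted. A run of length at least 2 then stands between different letters, which makes all runs
  -- equal, or inside a square, which starts a chain.
  square-case : ∀ i₀ → w i₀ ≡ w (suc i₀) → SquareResult
  square-case i₀ sq = split (delete-short i₀ short)
    where
    short : ∀ {i j} → CR w i j → w i ≡ w i₀ → j ≤ 2 + i
    short {i} {j} cr e = cancel-≤ i₀ (Core.bal core cr (square-return sq) e) refl (cong (2 +_) (+-comm i₀ i))
    split : Del (w i₀) → SquareResult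
    split D = at (double-run core gaps refl (sym sq))
      where
      open Deletion D renaming (core to core′)
      W = base-weighted B gaps f≥1 core′
      len′ : length A ≡ 2 + k
      len′ = suc-injective (trans (sym len) size)
      at : (∃ λ i → 2 ≤ f i) → SquareResult
      at (i₁ , 2≤) = decide (w (q i₁) ≟ w (q (suc i₁)))
        where
        decide : Dec (w (q i₁) ≡ w (q (suc i₁))) → SquareResult
        decide (no ne) = constant (weight-constant W (squarefree-unless W len′ 2≤ ne))
          where
          early : (∃ λ i → i < 3 × w i ≡ w (suc i)) → ∃ λ i → i < square-bound × w i ≡ w (suc i)
          early (i , i<3 , e) = i , ≤-trans i<3 (m≤m+n 3 _) , e
          constant : (∃ λ n → ∀ i → f i ≡ n) → SquareResult
          -- The period depends on the unbounded `n` here, so the early square is taken from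
          -- `run-early`.
          constant (n , fn) = constant-case D (<⇒≤ n≥2) fn , early (run-early gaps (λ i → subst (2 ≤_) (sym (fn i)) n≥2) R)
            where
            n≥2 : 2 ≤ n
            n≥2 = subst (2 ≤_) (fn i₁) 2≤
        decide (yes e) = finish (chain-step k 1 (3 + k) i₁ refl len′ gaps R W e)
          where
          finish : (∃ λ j → ∃ λ d → j ≤ k × 2 + j ≡ d ×
            Res w (σRange 1 (suc j) (ψ d (ψRange d ((3 + k) ∸ d) (constW (3 + k))))) (3 ^ (2 + k))) → SquareResult
          finish (j , d , j≤k , refl , res like p p≤ per) = inj₂ (pack (like-shift w (word2 (3 + k) (suc j)) like per)) , early (square-early per sq)
            where
            pack : (Σ (ℕ ↔ ℕ) λ π → ∃ λ s → ShiftUpTo π s (word2 (3 + k) (suc j)) w) →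
                   Σ (ℕ ↔ ℕ) λ π → ∃ λ s → ∃ λ j → 1 ≤ j × j ≤ suc k × ShiftUpTo π s (word2 (3 + k) j) w
            pack (π , s , h) = π , s , suc j , s≤s z≤n , s≤s j≤k , h
            early : (∃ λ i → i < p × w i ≡ w (suc i)) → ∃ λ i → i < square-bound × w i ≡ w (suc i)
            early (i , i<p , e) = i , ≤-trans i<p (≤-trans p≤ (m≤n+m (3 ^ (2 + k)) 3)) , e

  -- Some letter has a return `aba`. By balance its returns take at most three steps, and three
  -- would put a square at the centre. Runs longer than 1 are squares too, so case 1 holds with
  -- exponent 1.
  squarefree-case : (∀ i → w i ≢ w (suc i)) → Conclusion (3 + k) w
  squarefree-case nosq = at (center core (proj₂ (return core 0)))
    where
    at : (∃ λ m → w m ≡ w (suc m)) ⊎ (∃ λ m → CR w m (2 + m)) → Conclusion (3 + k) w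
    at (inj₁ (m , sq)) = ⊥-elim (nosq m sq)
    at (inj₂ (m , crm)) = constant-case D ≤-refl f≡1
      where
      short : ∀ {i j} → CR w i j → w i ≡ w m → j ≤ 2 + i
      short {i} {j} cr e with m≤n⇒m<n∨m≡n (cancel-≤ m (Core.bal core cr crm e) refl (cong (3 +_) (+-comm m i)))
      ... | inj₁ j<    = ≤-pred j<
      ... | inj₂ refl = ⊥-elim (nosq (suc i) (proj₁ (Core.pal core cr (1 + i) (2 + i) (ring i) (n≤1+n i) (m≤n+m i 2))))
        where
        ring : ∀ i → 1 + i + (2 + i) ≡ i + (3 + i)
        ring = solve-∀
      D = delete-short m short
      open Deletion D
      f≡1 : ∀ i → f i ≡ 1
      f≡1 i = ≤-antisym (≮⇒≥ λ 2≤ → nosq (suc (q i + 0)) (trans (Gaps.fill gaps i 0 (<⇒≤ 2≤))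
        (sym (trans (cong (w ∘ suc) (sym (+-suc (q i) 0))) (Gaps.fill gaps i 1 2≤))))) (f≥1 i)

theorem5p6 : (k : ℕ) → 3 ≤ k → (w : Word) →
    AlphabetExactly k w → Recurrent w → Balanced w → WeaklyRich w →
    (Σ (ℕ ↔ ℕ) λ π → ∃ λ s → ∃ λ n → 1 ≤ n × ShiftUpTo π s (word1 k n) w)
    ⊎ (Σ (ℕ ↔ ℕ) λ π → ∃ λ s → ∃ λ j → 1 ≤ j × j ≤ k ∸ 2 × ShiftUpTo π s (word2 k j) w)
theorem5p6 (suc (suc (suc k))) (s≤s (s≤s (s≤s z≤n))) w alph R B rich =
  decide (anyUpTo? (λ i → w i ≟ w (suc i)) (3 + 3 ^ (2 + k)))
  where
  -- If w contains a square of a letter at all, then it contains one below this bound.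
  decide : Dec (∃ λ i → i < 3 + 3 ^ (2 + k) × w i ≡ w (suc i)) → Conclusion (3 + k) w
  decide (yes (i , _ , sq)) = proj₁ (square-case alph R B rich i sq)
  decide (no none) = squarefree-case alph R B rich λ i sq → none (proj₂ (square-case alph R B rich i sq))
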